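{- For all positive integers $r$ and $n$ with $r \geq 3$, \[\mathrm{OR}_{\mathrm{mon}}(\mathcal{P}^r_{2n+r-1}) \geq \mathrm{tow}_{r-1}((1-o(1))n).\]
   Context: For an integer $r\ge 2$, an ordered $r$-uniform hypergraph is an $r$-uniform hypergraph together with a total order of its vertices; two such are isomorphic if there is a hypergraph isomorphism preserving the vertex orders, and an ordered sub-hypergraph is a sub-hypergraph with the induced order. $\mathcal{K}^r_N$ denotes the ordered complete $r$-uniform hypergraph on vertex set $\{1,\dots,N\}$ with the natural order, and $\mathcal{P}^r_n$ denotes the monotone $r$-uniform path on $n$ vertices: the ordered $r$-uniform hypergraph on vertices $u_1<\dots<u_n$ whose edges are the $r$-tuples $\{u_i,\dots,u_{i+r-1}\}$ of consecutive vertices. An $r$-monotone coloring of $\mathcal{K}^r_N$ is a map $c$ from the edges ($r$-subsets of $\{1,\dots,N\}$) to $\{ -1,+1\}$ such that for every $(r+1)$-tuple $v_1<\dots<v_{r+1}$ of vertices, writing $S=(v_1,\dots,v_{r+1})$ and $S^{(i)}$ for the $r$-set obtained by deleting $v_i$, for all $1\le i<j<k\le r+1$ we have $c(S^{(k)})\le c(S^{(j)})\le c(S^{(i)})$ or $c(S^{(k)})\ge c(S^{(j)})\ge c(S^{(i)})$ (equivalently, the sequence $(c(S^{(r+1)}),\dots,c(S^{(1)}))$ changes sign at most once). The monotone Ramsey number $\mathrm{OR}_{\mathrm{mon}}(\mathcal{H})$ of an ordered $r$-uniform hypergraph $\mathcal{H}$ is the minimum positive integer $N$ such that every $r$-monotone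 coloring of $\mathcal{K}^r_N$ contains an ordered sub-hypergraph that is monochromatic and isomorphic to $\mathcal{H}$. The tower function is $\mathrm{tow}_1(x)=x$ and $\mathrm{tow}_h(x)=2^{\mathrm{tow}_{h-1}(x)}$ for $h\ge 2$. The $o(1)$ term tends to $0$ as $n\to\infty$. -}

module Defs where

open import Data.Nat using (ℕ; zero; suc; _+_; _^_; _≤_; _<_)
open import Data.Nat.Properties using (+-monoˡ-<; ≤-trans; <-≤-trans; +-comm)
open import Data.Fin using (Fin; toℕ; fromℕ<) renaming (_<_ to _<ᶠ_)
open import Data.Fin.Properties using (toℕ<n)
open import Data.Vec using (Vec; lookup; tabulate; removeAt)
open import Data.Bool using (Bool) renaming (_≤_ to _≤ᵇ_)
open import Data.Product using (Σ; _×_)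
open import Data.Sum using (_⊎_)
open import Relation.Binary.PropositionalEquality using (_≡_; subst)

-- Tower function: tow 1 x = x, tow (h+1) x = 2 ^ tow h x  (tow 0 x := x, unused).
tow : ℕ → ℕ → ℕ
tow zero x = x
tow (suc zero) x = x
tow (suc (suc h)) x = 2 ^ tow (suc h) x

Increasing : {N m : ℕ} → Vec (Fin N) m → Set
Increasing {N} {m} v = (i j : Fin m) → i <ᶠ j → lookup v i <ᶠ lookup v j

-- An edge of K^r_N (an r-subset of the vertex set) is represented by the
-- increasing vector of its elements.  A 2-colouring assigns a colour to
-- every such vector; Bool stands for {-1,+1} with false = -1 < true = +1.
Colouring : ℕ → ℕ → Set
Colouring r N = Vec (Fin N) r → Bool

MonotoneColouring : (r N : ℕ) → Colouring r N → Set
MonotoneColouring r N c =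
  (v : Vec (Fin N) (suc r)) → Increasing v →
  (i j k : Fin (suc r)) → i <ᶠ j → j <ᶠ k →
  ((c (removeAt v k) ≤ᵇ c (removeAt v j)) × (c (removeAt v j) ≤ᵇ c (removeAt v i)))
  ⊎ ((c (removeAt v i) ≤ᵇ c (removeAt v j)) × (c (removeAt v j) ≤ᵇ c (removeAt v k)))

private
  windowBound : {r m i : ℕ} (j : Fin r) → i + r ≤ m → toℕ j + i < m
  windowBound {r} {m} {i} j p =
    <-≤-trans (+-monoˡ-< i (toℕ<n j)) (subst (_≤ m) (+-comm i r) p)

-- The edge {u_{i+1}, ..., u_{i+r}} of the monotone path on the vertices of u.
window : {N m : ℕ} (r : ℕ) → Vec (Fin N) m → (i : ℕ) → i + r ≤ m → Vec (Fin N) r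
window r u i p = tabulate (λ j → lookup u (fromℕ< (windowBound j p)))

HasMonoPath : (r m N : ℕ) → Colouring r N → Set
HasMonoPath r m N c =
  Σ (Vec (Fin N) m) λ u → Increasing u ×
  Σ Bool λ col → (i : ℕ) (p : i + r ≤ m) → c (window r u i p) ≡ col

-- Every r-monotone colouring of K^r_N contains a monochromatic P^r_m.
-- OR_mon(P^r_m) is the least positive N with this property, so
-- "OR_mon(P^r_m) ≥ T" means: every N with this property satisfies T ≤ N.
MonArrows : (r m N : ℕ) → Set
MonArrows r m N = (c : Colouring r N) → MonotoneColouring r N c → HasMonoPath r m N c

{-# OPTIONS --safe #-}
module Submission where

open import Defs
open import Data.Nat using (ℕ; suc; _+_; _*_; _∸_; _/_; _≤_)
open import Data.Product using (Σ)

open import Data.Bool using (Bool; true; false; not; _xor_; f≤t; b≤b) renaming (_≤_ to _≤ᵇ_)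
import Data.Bool.Properties as Bool
open import Data.Empty using (⊥)
open import Data.Fin as Fin using (Fin; toℕ)
open import Data.Fin.Properties using (toℕ<n; toℕ-fromℕ<)
open import Data.List using (List; []; _∷_; _++_; _∷ʳ_; map; reverse; length; take; drop; tabulate;
  initLast; _∷ʳ′_)
open import Data.List.Properties
open import Data.List.Relation.Unary.All as All using (All; []; _∷_)
import Data.List.Relation.Unary.All.Properties as All
open import Data.List.Relation.Unary.Linked as Linked using (Linked; []; [-]; _∷_; linked?)
open import Data.Nat using (zero; _^_; _<_; _>_; _⊔_; ⌊_/2⌋; ⌈_/2⌉; _≟_; _<?_; _>?_; _≤?_; z≤n; s≤s)
open import Data.Nat.DivMod using (m*n/n≡m; /-monoˡ-≤; m/n≤m)
open import Data.Nat.Properties hiding (_≟_; _<?_; _>?_; _≤?_)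
open import Data.Product using (_×_; _,_; proj₂; ∃; ∃₂)
open import Data.Sum using (_⊎_; inj₁; inj₂)
open import Data.Vec as Vec using (Vec; []; _∷_)
open import Data.Vec.Properties using (length-toList)
open import Relation.Binary using (tri<; tri≈; tri>)
open import Relation.Binary.PropositionalEquality
open import Relation.Nullary using (¬_; yes; no; contradiction)

-- The vertices at uniformity r are the naturals below tow (r ∸ 1) M, read in binary, and the
-- colourings are stepped up from r to suc r.  For vertices x₁ < … < xᵣ₊₁ let w be the word of
-- the positions of the highest bits in which consecutive xᵢ differ.  If w increases, the new
-- colour is the negated old colour of w; if w decreases, it is (up to a sign depending on the
-- parity of r) the old colour of the reversed word; otherwise it depends only on the direction
-- of the first monotone run of w and the parity of its length.  Deleting a vertex replaces two
-- consecutive letters of w by their maximum, and a case analysis on the shape of w shows that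
-- stepping up preserves monotonicity, provided the colouring is also monotone in the first and
-- in the last vertex. Along a monochromatic path the first-run parity rule forbids, for r ≥ 4,
-- any change of direction of w away from its ends, so each step lengthens the longest path by
-- O(r) only.  From r = 3 to 4 one change of direction is possible and the length doubles: this
-- is the factor 2 in the theorem.

-- The highest binary digit in which two numbers differ.

differ : ℕ → ℕ → ℕ → ℕ
differ zero    x y = 0
differ (suc f) x y with ⌊ x /2⌋ ≟ ⌊ y /2⌋
... | yes _ = 0
... | no  _ = suc (differ f ⌊ x /2⌋ ⌊ y /2⌋)

-- For `x < y` the fuel `y` lasts until the halves agree, so this is the position of the highest
-- differing bit, counted from 0 at the lowest bit.
δ : ℕ → ℕ → ℕ
δ x y = differ y x y

half-< : ∀ {x f} → x ≤ suc f → ⌊ x /2⌋ ≤ f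
half-< {zero}  _ = z≤n
half-< {suc x} p = ≤-pred (<-≤-trans (⌊n/2⌋<n x) p)

half-mono-< : ∀ {x y} → x < y → ⌊ x /2⌋ ≢ ⌊ y /2⌋ → ⌊ x /2⌋ < ⌊ y /2⌋
half-mono-< p q = ≤∧≢⇒< (⌊n/2⌋-mono (<⇒≤ p)) q

differ-stable : ∀ f g {x y} → x < y → y ≤ f → y ≤ g → differ f x y ≡ differ g x y
differ-stable zero g p q r = contradiction (<-≤-trans p q) λ ()
differ-stable (suc f) zero p q r = contradiction (<-≤-trans p r) λ ()
differ-stable (suc f) (suc g) {x} {y} p q r with ⌊ x /2⌋ ≟ ⌊ y /2⌋
... | yes _ = refl
... | no n = cong suc (differ-stable f g (half-mono-< p n) (half-< q) (half-< r))

-- Halving is monotone, so if the halves of `x` and `z` agree, the half of `y` is caught between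
-- them. If `y` joins just one of its neighbours, the other gap is the whole gap; otherwise halve
-- again.
differ-⊔ : ∀ f {x y z} → x ≤ y → y ≤ z → differ f x z ≡ differ f x y ⊔ differ f y z
differ-⊔ zero _ _ = refl
differ-⊔ (suc f) {x} {y} {z} p q
  with ⌊ x /2⌋ ≟ ⌊ z /2⌋ | ⌊ x /2⌋ ≟ ⌊ y /2⌋ | ⌊ y /2⌋ ≟ ⌊ z /2⌋
... | yes _ | yes _ | yes _ = refl
... | yes a | yes b | no  c = contradiction (trans (sym b) a) c
... | yes a | no  b | _     = contradiction
  (≤-antisym (⌊n/2⌋-mono p) (subst (⌊ y /2⌋ ≤_) (sym a) (⌊n/2⌋-mono q))) b
... | no  a | yes b | yes c = contradiction (trans b c) a
... | no  _ | yes b | no  _ = cong (λ h → suc (differ f h ⌊ z /2⌋)) b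
... | no  _ | no  _ | yes c = cong (λ h → suc (differ f ⌊ x /2⌋ h)) (sym c)
... | no  _ | no  _ | no  _ = cong suc (differ-⊔ f (⌊n/2⌋-mono p) (⌊n/2⌋-mono q))

δ-⊔ : ∀ {x y z} → x < y → y < z → δ x z ≡ δ x y ⊔ δ y z
δ-⊔ {x} {y} {z} p q = trans (differ-⊔ z (<⇒≤ p) (<⇒≤ q))
  (cong (_⊔ δ y z) (differ-stable z y p (<⇒≤ q) ≤-refl))

-- At a common position three distinct numbers would have the same half, but only two numbers share
-- a half.
differ-≢ : ∀ f {x y z} → x < y → y < z → z ≤ f → differ f x y ≢ differ f y z
differ-≢ zero p q r e = contradiction (<-≤-trans q r) λ ()
differ-≢ (suc f) {x} {y} {z} p q r e with ⌊ x /2⌋ ≟ ⌊ y /2⌋ | ⌊ y /2⌋ ≟ ⌊ z /2⌋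
... | yes a | yes b = 1+n≰n (subst (λ h → suc h ≤ ⌊ z /2⌋) (trans a b)
  (⌊n/2⌋-mono (≤-trans (s≤s p) q)))
... | yes _ | no  _ = contradiction e λ ()
... | no  _ | yes _ = contradiction e λ ()
... | no  a | no  b =
  differ-≢ f (half-mono-< p a) (half-mono-< q b) (half-< r) (suc-injective e)

δ-≢ : ∀ {x y z} → x < y → y < z → δ x y ≢ δ y z
δ-≢ {x} {y} {z} p q e = differ-≢ z p q ≤-refl
  (trans (differ-stable z y p (<⇒≤ q) ≤-refl) e)

half-<-2^ : ∀ {y V} → y < 2 ^ suc V → ⌊ y /2⌋ < 2 ^ V
half-<-2^ {y} {V} p = ≰⇒> λ q → <⇒≱ p (begin
  2 ^ V + (2 ^ V + 0)   ≡⟨ cong (2 ^ V +_) (+-identityʳ _) ⟩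
  2 ^ V + 2 ^ V         ≤⟨ +-mono-≤ q (≤-trans q (⌊n/2⌋≤⌈n/2⌉ y)) ⟩
  ⌊ y /2⌋ + ⌈ y /2⌉     ≡⟨ ⌊n/2⌋+⌈n/2⌉≡n y ⟩
  y                     ∎)
  where open ≤-Reasoning

differ-< : ∀ f V {x y} → x < y → y < 2 ^ V → differ f x y < V
differ-< f zero p q = contradiction (<-≤-trans p (≤-pred q)) λ ()
differ-< zero (suc V) p q = s≤s z≤n
differ-< (suc f) (suc V) {x} {y} p q with ⌊ x /2⌋ ≟ ⌊ y /2⌋
... | yes _ = s≤s z≤n
... | no  n = s≤s (differ-< f V (half-mono-< p n) (half-<-2^ {y} {V} q))

δ-< : ∀ V {x y} → x < y → y < 2 ^ V → δ x y < V
δ-< V {y = y} = differ-< y V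

-- Gap words and the deletion of a vertex.

Word : Set
Word = List ℕ

Inc Dec : Word → Set
Inc = Linked _<_
Dec = Linked _>_

gaps : Word → Word
gaps (x ∷ y ∷ l) = δ x y ∷ gaps (y ∷ l)
gaps _           = []

deletions : Word → List Word
deletions []      = []
deletions (x ∷ l) = l ∷ map (x ∷_) (deletions l)

-- The last entry drops the final letter, because deleting the last vertex loses the last gap.
merges : Word → List Word
merges []          = []
merges (a ∷ [])    = [] ∷ []
merges (a ∷ b ∷ w) = (a ⊔ b ∷ w) ∷ map (a ∷_) (merges (b ∷ w))

-- By `δ-⊔`, deleting an inner vertex replaces its two gaps by their maximum. Deleting the first
-- vertex leaves the tail of the gap word, which `merges` does not list.
gaps-deletions : ∀ {x y} l → Inc (x ∷ y ∷ l) →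
  map gaps (deletions (x ∷ y ∷ l)) ≡ gaps (y ∷ l) ∷ merges (gaps (x ∷ y ∷ l))
gaps-deletions [] _ = refl
gaps-deletions {x} {y} (z ∷ l) (p ∷ q ∷ i) = cong (gaps (y ∷ z ∷ l) ∷_) (cong₂ _∷_
  (cong (_∷ gaps (z ∷ l)) (δ-⊔ p q))
  (begin
    map gaps (map (x ∷_) (map (y ∷_) ds))       ≡⟨ map-∘ _ ⟨
    map (λ v → gaps (x ∷ v)) (map (y ∷_) ds)    ≡⟨ map-∘ _ ⟨
    map (λ v → δ x y ∷ gaps (y ∷ v)) ds         ≡⟨ map-∘ _ ⟩
    map (δ x y ∷_) (map (λ v → gaps (y ∷ v)) ds) ≡⟨ cong (map (δ x y ∷_)) (map-∘ _) ⟩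
    map (δ x y ∷_) (map gaps (map (y ∷_) ds))
      ≡⟨ cong (map (δ x y ∷_)) (∷-injectiveʳ (gaps-deletions l (q ∷ i))) ⟩
    map (δ x y ∷_) (merges (gaps (y ∷ z ∷ l)))  ∎))
  where
    open ≡-Reasoning
    ds = deletions (z ∷ l)

-- Neighbouring letters differ, and still do after two neighbours are replaced by their maximum;
-- at a valley this says that the letters on both sides of it differ.
data Proper : Word → Set where
  []   : Proper []
  [-]  : ∀ {a} → Proper (a ∷ [])
  pair : ∀ {a b} → a ≢ b → Proper (a ∷ b ∷ [])
  cons : ∀ {a b c w} → a ≢ b → a ⊔ b ≢ c → Proper (b ∷ c ∷ w) → Proper (a ∷ b ∷ c ∷ w)

gaps-proper : ∀ {l} → Inc l → Proper (gaps l)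
gaps-proper [] = []
gaps-proper [-] = []
gaps-proper (p ∷ [-]) = [-]
gaps-proper (p ∷ q ∷ [-]) = pair (δ-≢ p q)
gaps-proper (p ∷ q ∷ r ∷ i) = cons (δ-≢ p q)
  (λ e → δ-≢ (<-trans p q) r (trans (δ-⊔ p q) e)) (gaps-proper (q ∷ r ∷ i))

gaps-< : ∀ {V l} → Inc l → All (_< 2 ^ V) l → All (_< V) (gaps l)
gaps-< [] _ = []
gaps-< [-] _ = []
gaps-< {V} (p ∷ i) (_ ∷ q ∷ a) = δ-< V p q ∷ gaps-< i (q ∷ a)

length-gaps : ∀ x l → length (gaps (x ∷ l)) ≡ length l
length-gaps x [] = refl
length-gaps x (y ∷ l) = cong suc (length-gaps y l)

-- The stepped-up colouring and the shapes of words.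

even : ℕ → Bool
even zero    = true
even (suc n) = not (even n)

-- A first run of two letters gives `true` at a peak and `false` at a valley, and each further
-- letter of the run negates this. The final `true` is a default for words too short to turn.
turn : Word → Bool
turn (a ∷ b ∷ c ∷ w) with a <? b | b <? c | turn (b ∷ c ∷ w)
... | yes _ | yes _ | z = not z
... | yes _ | no  _ | _ = true
... | no  _ | yes _ | _ = false
... | no  _ | no  _ | z = not z
turn _ = true

lift : (Word → Bool) → Word → Bool
lift σ w with linked? _<?_ w | linked? _>?_ w
... | yes _ | _     = not (σ w)
... | no  _ | yes _ = not (even (length w) xor σ (reverse w))
... | no  _ | no  _ = turn w

-- Zig w z: w is not monotone and its colour, read off the first run, is z.
data Zig : Word → Bool → Set where
  peak   : ∀ {a b c w} → a < b → b > c → Zig (a ∷ b ∷ c ∷ w) true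
  valley : ∀ {a b c w} → a > b → b < c → Zig (a ∷ b ∷ c ∷ w) false
  up     : ∀ {a b c w z} → a < b → b < c → Zig (b ∷ c ∷ w) z → Zig (a ∷ b ∷ c ∷ w) (not z)
  down   : ∀ {a b c w z} → a > b → b > c → Zig (b ∷ c ∷ w) z → Zig (a ∷ b ∷ c ∷ w) (not z)

-- Asking for two letters in `dec` keeps it disjoint from `inc`.
data Shape : Word → Set where
  inc : ∀ {w} → Inc w → Shape w
  dec : ∀ {a b w} → Dec (a ∷ b ∷ w) → Shape (a ∷ b ∷ w)
  zig : ∀ {w z} → Zig w z → Shape w

proper-≢ : ∀ {a b w} → Proper (a ∷ b ∷ w) → a ≢ b
proper-≢ (pair n)     = n
proper-≢ (cons n _ _) = n

shape : ∀ {w} → Proper w → Shape w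
shape [] = inc []
shape [-] = inc [-]
shape (pair {a} {b} n) with <-cmp a b
... | tri< p _ _ = inc (p ∷ [-])
... | tri≈ _ e _ = contradiction e n
... | tri> _ _ p = dec (p ∷ [-])
shape (cons {a} {b} {c} n _ pr) with <-cmp a b | <-cmp b c | shape pr
... | tri≈ _ e _ | _          | _                = contradiction e n
... | _          | tri≈ _ e _ | _                = contradiction e (proper-≢ pr)
... | tri< p _ _ | tri> _ _ q | _                = zig (peak p q)
... | tri> _ _ p | tri< q _ _ | _                = zig (valley p q)
... | tri< p _ _ | tri< q _ _ | inc i            = inc (p ∷ i)
... | tri< _ _ _ | tri< q _ _ | dec (r ∷ _)      = contradiction r (<-asym q)
... | tri< p _ _ | tri< q _ _ | zig s            = zig (up p q s)
... | tri> _ _ p | tri> _ _ q | inc (r ∷ _)      = contradiction r (<-asym q)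
... | tri> _ _ p | tri> _ _ q | dec d            = dec (p ∷ d)
... | tri> _ _ p | tri> _ _ q | zig s            = zig (down p q s)

zig-¬inc : ∀ {w z} → Zig w z → ¬ Inc w
zig-¬inc (peak p q) (_ ∷ r ∷ _) = <-asym q r
zig-¬inc (valley p q) (r ∷ _) = <-asym p r
zig-¬inc (up _ _ s) (_ ∷ i) = zig-¬inc s i
zig-¬inc (down _ _ s) (_ ∷ i) = zig-¬inc s i

zig-¬dec : ∀ {w z} → Zig w z → ¬ Dec w
zig-¬dec (peak p q) (r ∷ _) = <-asym p r
zig-¬dec (valley p q) (_ ∷ r ∷ _) = <-asym q r
zig-¬dec (up _ _ s) (_ ∷ i) = zig-¬dec s i
zig-¬dec (down _ _ s) (_ ∷ i) = zig-¬dec s i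

zig-turn : ∀ {w z} → Zig w z → turn w ≡ z
zig-turn (peak {a} {b} {c} p q) with a <? b | b <? c
... | yes _ | yes r = contradiction q (<-asym r)
... | yes _ | no  _ = refl
... | no n  | _     = contradiction p n
zig-turn (valley {a} {b} {c} p q) with a <? b | b <? c
... | yes r | _     = contradiction p (<-asym r)
... | no  _ | yes _ = refl
... | no  _ | no  n = contradiction q n
zig-turn (up {a} {b} {c} p q s) with a <? b | b <? c
... | yes _ | yes _ = cong not (zig-turn s)
... | yes _ | no  n = contradiction q n
... | no n  | _     = contradiction p n
zig-turn (down {a} {b} {c} p q s) with a <? b | b <? c
... | yes r | _     = contradiction p (<-asym r)
... | no  _ | yes r = contradiction q (<-asym r)
... | no  _ | no  n = cong not (zig-turn s)

module _ (σ : Word → Bool) where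

  lift-inc : ∀ {w} → Inc w → lift σ w ≡ not (σ w)
  lift-inc {w} i with linked? _<?_ w
  ... | yes _ = refl
  ... | no n = contradiction i n

  -- A word of at most one letter is also increasing, and `lift` tests for that first; hence the
  -- bound on the length.
  lift-dec : ∀ {w} → Dec w → 2 ≤ length w →
    lift σ w ≡ not (even (length w) xor σ (reverse w))
  lift-dec {w} d _ with linked? _<?_ w | linked? _>?_ w
  ... | no _ | yes _ = refl
  ... | no _ | no n  = contradiction d n
  lift-dec [-] (s≤s ()) | yes _ | _
  lift-dec (p ∷ _) _ | yes (q ∷ _) | _ = contradiction p (<-asym q)

  lift-zig : ∀ {w z} → Zig w z → lift σ w ≡ z
  lift-zig {w} s with linked? _<?_ w | linked? _>?_ w
  ... | yes i | _     = contradiction i (zig-¬inc s)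
  ... | no _  | yes d = contradiction d (zig-¬dec s)
  ... | no _  | no _  = zig-turn s

-- Colour sequences with at most one change of sign.

data Seg (a z : Bool) : List Bool → Set where
  rest : ∀ {l} → All (_≡ z) l → Seg a z l
  _∷_  : ∀ {b l} → b ≡ a → Seg a z l → Seg a z (b ∷ l)

-- The indices `a` and `z` are the colours before and after the change and may coincide; carrying
-- them lets maps and reversal act on them directly.
Monotone : List Bool → Set
Monotone l = ∃₂ λ a z → Seg a z l

seg-map : ∀ {a z l} (f : Bool → Bool) → Seg a z l → Seg (f a) (f z) (map f l)
seg-map f (rest p) = rest (All.map⁺ (All.map (cong f) p))
seg-map f (p ∷ s) = cong f p ∷ seg-map f s

seg-dup : ∀ {a z b l} → Seg a z (b ∷ l) → Seg a z (b ∷ b ∷ l)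
seg-dup (rest (p ∷ ps)) = rest (p ∷ p ∷ ps)
seg-dup (p ∷ s) = p ∷ p ∷ s

seg-∷ʳ : ∀ {a z l} → Seg a z l → Seg a z (l ∷ʳ z)
seg-∷ʳ (rest p) = rest (All.∷ʳ⁺ p refl)
seg-∷ʳ (p ∷ s) = p ∷ seg-∷ʳ s

all-reverse : ∀ {z : Bool} {l} → All (_≡ z) l → All (_≡ z) (reverse l)
all-reverse [] = []
all-reverse {l = b ∷ l} (p ∷ ps) rewrite unfold-reverse b l = All.∷ʳ⁺ (all-reverse ps) p

all-seg : ∀ {a z l} → All (_≡ a) l → Seg a z l
all-seg [] = rest []
all-seg (p ∷ ps) = p ∷ all-seg ps

seg-reverse : ∀ {a z l} → Seg a z l → Seg z a (reverse l)
seg-reverse (rest p) = all-seg (all-reverse p)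
seg-reverse {l = b ∷ l} (refl ∷ s) rewrite unfold-reverse b l = seg-∷ʳ (seg-reverse s)

seg-dupʳ : ∀ {a z b} l → Seg a z (l ∷ʳ b) → Seg a z (l ∷ʳ b ∷ʳ b)
seg-dupʳ []      s        = seg-dup s
seg-dupʳ (_ ∷ l) (rest p) = rest (All.∷ʳ⁺ p (proj₂ (All.∷ʳ⁻ {xs = _ ∷ l} p)))
seg-dupʳ (_ ∷ l) (p ∷ s)  = p ∷ seg-dupʳ l s

not-mono : ∀ {x y} → x ≤ᵇ y → not y ≤ᵇ not x
not-mono f≤t = f≤t
not-mono b≤b = b≤b

-- The parity in last-≤ records that each step reverses the direction of monotonicity in the last
-- vertex, the negation in lift keeping that of the first.  Words of length 2 have no room for a
-- turn, which is why the colouring of pairs is pinned down.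
record Signotope (r : ℕ) (σ : Word → Bool) : Set where
  field
    monotone : ∀ {w} → Inc w → length w ≡ suc r → Monotone (map σ (deletions w))
    first-≤  : ∀ {a b w} → a < b → Inc (a ∷ w) → Inc (b ∷ w) → suc (length w) ≡ r →
            σ (a ∷ w) ≤ᵇ σ (b ∷ w)
    last-≤   : ∀ {a b} w → a < b → Inc (w ∷ʳ a) → Inc (w ∷ʳ b) → suc (length w) ≡ r →
            (even r xor σ (w ∷ʳ a)) ≤ᵇ (even r xor σ (w ∷ʳ b))
    pairs    : r ≡ 2 → ∀ w → σ w ≡ false

-- Monotone words under extension, reversal, deletion and merging.

module _ {R : ℕ → ℕ → Set} where

  linked-∷ʳ : ∀ {a b} w → Linked R (w ∷ʳ a) → R a b → Linked R (w ∷ʳ a ∷ʳ b)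
  linked-∷ʳ []          [-]     q = q ∷ [-]
  linked-∷ʳ (_ ∷ [])    (p ∷ l) q = p ∷ linked-∷ʳ [] l q
  linked-∷ʳ (_ ∷ y ∷ w) (p ∷ l) q = p ∷ linked-∷ʳ (y ∷ w) l q

  linked-∷ʳ⁻ : ∀ {a b} w → Linked R (w ∷ʳ a ∷ʳ b) → Linked R (w ∷ʳ a) × R a b
  linked-∷ʳ⁻ []          (p ∷ l) = [-] , p
  linked-∷ʳ⁻ (_ ∷ [])    (p ∷ l) with k , q ← linked-∷ʳ⁻ [] l = p ∷ k , q
  linked-∷ʳ⁻ (_ ∷ y ∷ w) (p ∷ l) with k , q ← linked-∷ʳ⁻ (y ∷ w) l = p ∷ k , q

  linked-reverse : ∀ {w} → Linked (λ x y → R y x) w → Linked R (reverse w)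
  linked-reverse []  = []
  linked-reverse [-] = [-]
  linked-reverse {a ∷ b ∷ w} (p ∷ l)
    rewrite unfold-reverse a (b ∷ w) | unfold-reverse b w =
    linked-∷ʳ (reverse w) (subst (Linked R) (unfold-reverse b w) (linked-reverse l)) p

  linked-deletions : (∀ {x y z} → R x y → R y z → R x z) →
    ∀ {w} → Linked R w → All (Linked R) (deletions w)
  linked-deletions t []  = []
  linked-deletions t [-] = [] ∷ []
  linked-deletions t {a ∷ b ∷ w} (p ∷ l) =
    l ∷ skip l ∷ All.map⁺ (All.map⁺ (All.map (p ∷_) (All.map⁻ (All.tail (linked-deletions t l)))))
    where
    skip : ∀ {w} → Linked R (b ∷ w) → Linked R (a ∷ w)
    skip [-] = [-]
    skip (q ∷ k) = t p q ∷ k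

-- In a rise the maximum is the later letter, so each merge deletes the earlier one.
inc-merges : ∀ {w} → Inc w → merges w ≡ deletions w
inc-merges []  = refl
inc-merges [-] = refl
inc-merges (p ∷ i) = cong₂ _∷_ (cong (_∷ _) (m≤n⇒m⊔n≡n (<⇒≤ p))) (cong (map _) (inc-merges i))

-- In a fall a merge deletes the later letter. Together with the tail `w` this lists every deletion
-- once, except the last, which occurs both as a merge and as the dropped final letter.
dec-merges : ∀ {a w} → Dec (a ∷ w) → ∃₂ λ ds y →
  deletions (a ∷ w) ≡ ds ∷ʳ y × w ∷ merges (a ∷ w) ≡ ds ∷ʳ y ∷ʳ y
dec-merges [-] = [] , [] , refl , refl
dec-merges {a} {b ∷ w} (p ∷ d) with ds , y , e , f ← dec-merges d =
  (b ∷ w) ∷ map (a ∷_) ds , a ∷ y ,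
  cong ((b ∷ w) ∷_) (trans (cong (map (a ∷_)) e) (map-++ (a ∷_) ds (y ∷ []))) ,
  cong ((b ∷ w) ∷_) (begin
    (a ⊔ b ∷ w) ∷ map (a ∷_) (merges (b ∷ w))
      ≡⟨ cong (λ m → (m ∷ w) ∷ map (a ∷_) (merges (b ∷ w))) (m≥n⇒m⊔n≡m (<⇒≤ p)) ⟩
    map (a ∷_) (w ∷ merges (b ∷ w))        ≡⟨ cong (map (a ∷_)) f ⟩
    map (a ∷_) (ds ∷ʳ y ∷ʳ y)              ≡⟨ map-++ (a ∷_) (ds ∷ʳ y) (y ∷ []) ⟩
    map (a ∷_) (ds ∷ʳ y) ∷ʳ (a ∷ y)        ≡⟨ cong (_∷ʳ (a ∷ y)) (map-++ (a ∷_) ds (y ∷ [])) ⟩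
    map (a ∷_) ds ∷ʳ (a ∷ y) ∷ʳ (a ∷ y)    ∎)
  where open ≡-Reasoning

reverse-∷ʳ : ∀ (w : Word) x → reverse (w ∷ʳ x) ≡ x ∷ reverse w
reverse-∷ʳ w x = reverse-++ w (x ∷ [])

length-∷ʳ : ∀ (w : Word) x → length (w ∷ʳ x) ≡ suc (length w)
length-∷ʳ w x = trans (length-++ w) (+-comm (length w) 1)

deletions-∷ʳ : ∀ w a → deletions (w ∷ʳ a) ≡ map (_∷ʳ a) (deletions w) ∷ʳ w
deletions-∷ʳ []      a = refl
deletions-∷ʳ (b ∷ w) a = cong (w ∷ʳ a ∷_) (begin
  map (b ∷_) (deletions (w ∷ʳ a))                        ≡⟨ cong (map (b ∷_)) (deletions-∷ʳ w a) ⟩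
  map (b ∷_) (map (_∷ʳ a) (deletions w) ∷ʳ w)            ≡⟨ map-++ (b ∷_) _ (w ∷ []) ⟩
  map (b ∷_) (map (_∷ʳ a) (deletions w)) ∷ʳ (b ∷ w)      ≡⟨ cong (_∷ʳ (b ∷ w)) (map-∘ _) ⟨
  map (λ v → b ∷ v ∷ʳ a) (deletions w) ∷ʳ (b ∷ w)        ≡⟨ cong (_∷ʳ (b ∷ w)) (map-∘ _) ⟩
  map (_∷ʳ a) (map (b ∷_) (deletions w)) ∷ʳ (b ∷ w)      ∎)
  where open ≡-Reasoning

deletions-reverse : ∀ w → map reverse (deletions w) ≡ reverse (deletions (reverse w))
deletions-reverse [] = refl
deletions-reverse (a ∷ w) = sym (begin
  reverse (deletions (reverse (a ∷ w)))
    ≡⟨ cong (λ v → reverse (deletions v)) (unfold-reverse a w) ⟩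
  reverse (deletions (reverse w ∷ʳ a))
    ≡⟨ cong reverse (deletions-∷ʳ (reverse w) a) ⟩
  reverse (map (_∷ʳ a) (deletions (reverse w)) ∷ʳ reverse w)
    ≡⟨ reverse-++ (map (_∷ʳ a) (deletions (reverse w))) _ ⟩
  reverse w ∷ reverse (map (_∷ʳ a) (deletions (reverse w)))
    ≡⟨ cong (reverse w ∷_) (reverse-map (_∷ʳ a) (deletions (reverse w))) ⟨
  reverse w ∷ map (_∷ʳ a) (reverse (deletions (reverse w)))
    ≡⟨ cong (λ v → reverse w ∷ map (_∷ʳ a) v) (deletions-reverse w) ⟨
  reverse w ∷ map (_∷ʳ a) (map reverse (deletions w))
    ≡⟨ cong (reverse w ∷_) (map-∘ _) ⟨
  reverse w ∷ map (λ v → reverse v ∷ʳ a) (deletions w)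
    ≡⟨ cong (reverse w ∷_) (map-cong (unfold-reverse a) (deletions w)) ⟨
  reverse w ∷ map (λ v → reverse (a ∷ v)) (deletions w)
    ≡⟨ cong (reverse w ∷_) (map-∘ _) ⟩
  reverse w ∷ map reverse (map (a ∷_) (deletions w)) ∎)
  where open ≡-Reasoning

length-deletions : ∀ w → All (λ v → suc (length v) ≡ length w) (deletions w)
length-deletions [] = []
length-deletions (a ∷ w) = refl ∷ All.map⁺ (All.map (cong suc) (length-deletions w))

length-merges : ∀ w → All (λ v → suc (length v) ≡ length w) (merges w)
length-merges [] = []
length-merges (a ∷ []) = refl ∷ []
length-merges (a ∷ b ∷ w) = refl ∷ All.map⁺ (All.map (cong suc) (length-merges (b ∷ w)))

-- The merges of a word that is not monotone.

Head≥ : ℕ → Word → Set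
Head≥ d v = ∃₂ λ u w → v ≡ u ∷ w × d ≤ u

head-merges : ∀ d e w → All (Head≥ d) (merges (d ∷ e ∷ w))
head-merges d e w = (d ⊔ e , w , refl , m≤m⊔n d e) ∷
  All.map⁺ (All.universal (λ v → d , v , refl , ≤-refl) (merges (e ∷ w)))

-- The shape of the merges of a word whose first run has length ≥ 2: words of colour z, then words of
-- colour not z, separated by at most two equal words (a valley letter merged with either neighbour)
-- of arbitrary colour.  Near the end of the list monotone words can occur, related by R.
data Pattern (R : Bool → Word → Word → Set) (z : Bool) : List Word → Set where
  free : ∀ {v} → Pattern R z (v ∷ [])
  rest : ∀ {l} → All (λ v → Zig v (not z)) l → Pattern R z l
  twin : ∀ {v l} → All (λ v → Zig v (not z)) l → Pattern R z (v ∷ v ∷ l)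
  ends : ∀ {v v′} → R z v v′ → Pattern R z (v ∷ v ∷ v′ ∷ [])
  _∷_  : ∀ {v l} → Zig v z → Pattern R z l → Pattern R z (v ∷ l)

pattern-map : ∀ {R z l} {P : Word → Set} a →
  (∀ {z v} → P v → Zig v z → Zig (a ∷ v) (not z)) →
  (∀ {z v v′} → P v → P v′ → R z v v′ → R (not z) (a ∷ v) (a ∷ v′)) →
  All P l → Pattern R z l → Pattern R (not z) (map (a ∷_) l)
pattern-map a f g _ free = free
pattern-map a f g p (rest q) = rest (All.map⁺ (All.zipWith (λ (x , y) → f x y) (p , q)))
pattern-map a f g (_ ∷ _ ∷ p) (twin q) =
  twin (All.map⁺ (All.zipWith (λ (x , y) → f x y) (p , q)))
pattern-map a f g (p ∷ _ ∷ q ∷ []) (ends r) = ends (g p q r)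
pattern-map a f g (p ∷ ps) (q ∷ s) = f p q ∷ pattern-map a f g ps s

Climb : ℕ → Word → Set
Climb b v = ∃₂ λ u w → v ≡ b ∷ u ∷ w × b < u

Drop : ℕ → Word → Set
Drop c v = ∃₂ λ u w → v ≡ c ∷ u ∷ w × u < c

-- The possible merges from a peak `c` onwards: the fall after it continues (`all`), the word ends
-- after one letter (`pair`), or a valley follows at once and is swallowed from either side with the
-- same result (`twin`).
data Top (c : ℕ) (w : Word) : List Word → Set where
  all  : ∀ {l} → All (Drop c) l → Top c w l
  pair : ∀ v → Top c w (v ∷ v ∷ [])
  twin : ∀ v {l} → Zig (c ∷ w) false → All (Drop c) l → Top c w (v ∷ v ∷ l)

top : ∀ {c d w} → c > d → Proper (d ∷ w) → Top c (d ∷ w) (merges (c ∷ d ∷ w))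
top {c} {d} {[]} p _ rewrite m≥n⇒m⊔n≡m (<⇒≤ p) = pair (c ∷ [])
top {c} {d} {e ∷ w} p pr rewrite m≥n⇒m⊔n≡m (<⇒≤ p) with <-cmp d e
... | tri≈ _ q _ = contradiction q (proper-≢ pr)
... | tri< q _ _ rewrite m≤n⇒m⊔n≡n (<⇒≤ q) = twin (c ∷ e ∷ w) (valley p q)
  (All.map⁺ (All.map⁺ (All.universal (λ v → d , v , refl , p) (merges (e ∷ w)))))
... | tri> _ _ q rewrite m≥n⇒m⊔n≡m (<⇒≤ q) = all
  ((e , w , refl , <-trans q p) ∷ (d , w , refl , p) ∷
   All.map⁺ (All.map⁺ (All.universal (λ v → d , v , refl , p) (merges (e ∷ w)))))

None : Bool → Word → Word → Set
None _ _ _ = ⊥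

top-pattern : ∀ {a b c w l} → a < b → b < c → Top c w l →
  Pattern None true (map (a ∷_) (map (b ∷_) l))
top-pattern p q (all ds) =
  rest (All.map⁺ (All.map⁺ (All.map (λ { (_ , _ , refl , r) → up p q (peak q r) }) ds)))
top-pattern p q (pair v) = twin []
top-pattern p q (twin v _ ds) =
  twin (All.map⁺ (All.map⁺ (All.map (λ { (_ , _ , refl , r) → up p q (peak q r) }) ds)))

proper-tail : ∀ {a w} → Proper (a ∷ w) → Proper w
proper-tail [-] = []
proper-tail (pair _) = [-]
proper-tail (cons _ _ p) = p

-- A merge inside the first run shortens it by one letter and gives colour `z`; a later merge keeps
-- its length and gives `not z`. If swallowing the letter after the peak leaves the colour open, it
-- yields two equal words.
pattern-up : ∀ {a b c w z} → a < b → b < c → Proper (b ∷ c ∷ w) → Zig (b ∷ c ∷ w) z →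
  Pattern None z (map (a ∷_) (merges (b ∷ c ∷ w)))
pattern-up {w = d ∷ w} p q pr (peak _ r) rewrite m≤n⇒m⊔n≡n (<⇒≤ q) =
  peak (<-trans p q) r ∷ top-pattern p q (top r (proper-tail (proper-tail pr)))
pattern-up {a} {b} {c} {d ∷ w} p q pr (up _ r s) rewrite m≤n⇒m⊔n≡n (<⇒≤ q) =
  up (<-trans p q) r s ∷
  pattern-map {P = Climb b} a (λ { (u , w , refl , t) → up p t }) (λ _ _ ())
    (All.map⁺ (All.map (λ { (u , w , refl , t) → u , w , refl , <-≤-trans q t })
      (head-merges c d w)))
    (pattern-up q r (proper-tail pr) s)
pattern-up p q pr (valley r _) = contradiction q (<-asym r)
pattern-up p q pr (down r _ _) = contradiction q (<-asym r)

-- Arises from a word that decreases up to its last letter.  There the length fixes the colour z of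
-- the preceding words, and first-≤ compares the colours of v and v′.
Lowered : Bool → Word → Word → Set
Lowered z v v′ = z ≡ even (length v) × Dec v × Dec v′ ×
  ∃ λ w → ∃₂ λ a b → v ≡ w ∷ʳ a × v′ ≡ w ∷ʳ b × b < a

-- The colour depends only on the directions of the steps, not on the size of the first letter.
zig-head : ∀ {a b c w z} → Zig (b ∷ c ∷ w) z → b > c → a > c → Zig (a ∷ c ∷ w) z
zig-head (peak r _)   p q = contradiction p (<-asym r)
zig-head (up r _ _)   p q = contradiction p (<-asym r)
zig-head (valley _ r) p q = valley q r
zig-head (down _ r s) p q = down q r s

-- As for a rising run, merges inside the run give `z` and later ones `not z`. The new case is a
-- valley just before the final letter, where a merge and the dropped final letter may both leave a
-- decreasing word.
pattern-down : ∀ {a b c w z} → a > b → b > c → Proper (b ∷ c ∷ w) → Zig (b ∷ c ∷ w) z →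
  Pattern Lowered z (map (a ∷_) (merges (b ∷ c ∷ w)))
pattern-down {a} {b} {c} {d ∷ w} p q (cons _ n _) (valley _ r)
  rewrite m≥n⇒m⊔n≡m (<⇒≤ q) | m≤n⇒m⊔n≡n (<⇒≤ r) = go w
  where
  go : ∀ w → Pattern Lowered false
    ((a ∷ b ∷ d ∷ w) ∷ (a ∷ b ∷ d ∷ w) ∷
     map (a ∷_) (map (b ∷_) (map (c ∷_) (merges (d ∷ w)))))
  -- Whether the merged word still turns depends on the two sides of the valley; properness makes
  -- them differ.
  go [] with <-cmp b d
  ... | tri< s _ _ = valley p s ∷ valley p s ∷ free
  ... | tri≈ _ e _ = contradiction e n
  ... | tri> _ _ s = ends (refl , p ∷ s ∷ [-] , p ∷ q ∷ [-] , a ∷ b ∷ [] , d , c , refl , refl , r)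
  go (e ∷ w) = twin (All.map⁺ (All.map⁺ (All.map⁺
    (All.map (λ { (_ , _ , refl , s) → down p q (valley q (<-≤-trans r s)) })
      (head-merges d e w)))))
pattern-down {a} {b} {c} {d ∷ w} p q pr (down _ r s) rewrite m≥n⇒m⊔n≡m (<⇒≤ q) =
  down p (<-trans r q) (zig-head s r (<-trans r q)) ∷
  pattern-map {P = Drop b} a
    (λ { (u , w , refl , t) → down p t })
    (λ { (u , w , refl , t) (u′ , w′ , refl , t′) (e , d , d′ , v , x , y , f , f′ , o) →
      cong not e , p ∷ d , p ∷ d′ , a ∷ v , x , y , cong (a ∷_) f , cong (a ∷_) f′ , o })
    (All.map⁺ (heads w))
    (pattern-down q r (proper-tail pr) s)
  where
  heads : ∀ w → All (λ v → Drop b (b ∷ v)) (merges (c ∷ d ∷ w))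
  heads w = (c ⊔ d , w , refl , subst (_< b) (sym (m≥n⇒m⊔n≡m (<⇒≤ r))) q) ∷
    All.map⁺ (All.universal (λ v → c , v , refl , q) (merges (d ∷ w)))
pattern-down p q pr (peak r _) = contradiction q (<-asym r)
pattern-down p q pr (up r _ _) = contradiction q (<-asym r)

-- Stepping up preserves monotonicity.

seg-twin : ∀ {z} b {l} → All (_≡ not z) l → Seg z (not z) (b ∷ b ∷ l)
seg-twin {z} b p with b Bool.≟ z
... | yes e = e ∷ e ∷ rest p
... | no  n = rest (Bool.¬-not n ∷ Bool.¬-not n ∷ p)

seg-single : ∀ {z} b → Seg z (not z) (b ∷ [])
seg-single {z} b with b Bool.≟ z
... | yes e = e ∷ rest []
... | no  n = rest (Bool.¬-not n ∷ [])

seg-falling : ∀ {b c l} → c ≤ᵇ b → All (_≡ false) l → Seg true false (b ∷ c ∷ c ∷ l)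
seg-falling f≤t ps = refl ∷ rest (refl ∷ refl ∷ ps)
seg-falling {false} b≤b ps = rest (refl ∷ refl ∷ refl ∷ ps)
seg-falling {true}  b≤b ps = refl ∷ refl ∷ refl ∷ rest ps

-- The parity that twists the colour of decreasing words is also the colour `z` of the words before
-- them, so a change here runs from `z` to `not z` and not back.
seg-lowered : ∀ {z b c} → c ≤ᵇ b →
  Seg z (not z) (not (z xor b) ∷ not (z xor b) ∷ not (z xor c) ∷ [])
seg-lowered {false} f≤t = refl ∷ refl ∷ rest (refl ∷ [])
seg-lowered {true}  f≤t = refl ∷ refl ∷ rest (refl ∷ [])
seg-lowered {z} {b} b≤b with not (z xor b) Bool.≟ z
... | yes e = e ∷ e ∷ e ∷ rest []
... | no  n = rest (Bool.¬-not n ∷ Bool.¬-not n ∷ Bool.¬-not n ∷ [])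

module _ {r : ℕ} {σ : Word → Bool} (S : Signotope r σ) (2≤r : 2 ≤ r) where
  open Signotope S

  private
    L = lift σ

    colours : ∀ {P : Word → Set} {z ws} → (∀ {w} → P w → Zig w z) → All P ws → All (_≡ z) (map L ws)
    colours f ps = All.map⁺ (All.map (λ p → lift-zig σ (f p)) ps)

  lowered-colours : ∀ {v v′ z} → length v ≡ r → length v′ ≡ r → Lowered z v v′ →
    Seg z (not z) (L v ∷ L v ∷ L v′ ∷ [])
  lowered-colours {v} {v′} m m′ (refl , d , d′ , w , a , b , refl , refl , b<a)
    rewrite lift-dec σ d (subst (2 ≤_) (sym m) 2≤r) | lift-dec σ d′ (subst (2 ≤_) (sym m′) 2≤r)
          | trans m′ (sym m) = seg-lowered le
    where
    le : σ (reverse (w ∷ʳ b)) ≤ᵇ σ (reverse (w ∷ʳ a))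
    le rewrite reverse-∷ʳ w a | reverse-∷ʳ w b = first-≤ b<a
      (subst Inc (reverse-∷ʳ w b) (linked-reverse d′))
      (subst Inc (reverse-∷ʳ w a) (linked-reverse d))
      (trans (cong suc (length-reverse w)) (trans (sym (length-∷ʳ w a)) m))

  pattern-colours : ∀ {R z l} →
    (∀ {v v′} → length v ≡ r → length v′ ≡ r → R z v v′ → Seg z (not z) (L v ∷ L v ∷ L v′ ∷ [])) →
    All (λ v → length v ≡ r) l → Pattern R z l → Seg z (not z) (map L l)
  pattern-colours h _ free = seg-single _
  pattern-colours h _ (rest ps) = rest (colours (λ p → p) ps)
  pattern-colours h _ (twin ps) = seg-twin _ (colours (λ p → p) ps)
  pattern-colours h (m ∷ _ ∷ m′ ∷ []) (ends e) = h m m′ e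
  pattern-colours h (_ ∷ ms) (p ∷ ps) = lift-zig σ p ∷ pattern-colours h ms ps

  inc-colours : ∀ {a w} → Inc (a ∷ w) → length w ≡ r → Monotone (map L (w ∷ merges (a ∷ w)))
  inc-colours {a} {w} i m rewrite inc-merges i with x , z , s ← monotone i (cong suc m) =
    not x , not z , seg-dup (subst (Seg (not x) (not z)) (sym eq) (seg-map not s))
    where
    eq : map L (deletions (a ∷ w)) ≡ map not (map σ (deletions (a ∷ w)))
    eq = trans (map-cong-local (All.map (lift-inc σ) (linked-deletions <-trans i))) (map-∘ _)

  -- Reversal reduces to the increasing case. All deletions have length `r`, so the same map `g`
  -- twists every colour, and only the last one is repeated.
  dec-colours : ∀ {a w} → Dec (a ∷ w) → length w ≡ r → Monotone (map L (w ∷ merges (a ∷ w)))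
  dec-colours {a} {w} d m
    with ds , y , e , f ← dec-merges d
       | x , z , s ← monotone {w = reverse (a ∷ w)} (linked-reverse d)
           (trans (length-reverse (a ∷ w)) (cong suc m)) =
    g z , g x , subst (Seg (g z) (g x)) (sym goal)
      (seg-dupʳ (map L ds) (subst (Seg (g z) (g x)) eq
        (seg-map g (seg-reverse {l = map σ (deletions (reverse (a ∷ w)))} s))))
    where
    open ≡-Reasoning
    g = λ b → not (even r xor b)
    v = a ∷ w
    goal : map L (w ∷ merges v) ≡ map L ds ∷ʳ L y ∷ʳ L y
    goal = begin
      map L (w ∷ merges v)      ≡⟨ cong (map L) f ⟩
      map L (ds ∷ʳ y ∷ʳ y)      ≡⟨ map-++ L (ds ∷ʳ y) _ ⟩
      map L (ds ∷ʳ y) ∷ʳ L y    ≡⟨ cong (_∷ʳ L y) (map-++ L ds _) ⟩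
      map L ds ∷ʳ L y ∷ʳ L y    ∎
    eq : map g (reverse (map σ (deletions (reverse v)))) ≡ map L ds ∷ʳ L y
    eq = begin
      map g (reverse (map σ (deletions (reverse v))))
        ≡⟨ cong (map g) (reverse-map σ (deletions (reverse v))) ⟨
      map g (map σ (reverse (deletions (reverse v))))
        ≡⟨ cong (λ u → map g (map σ u)) (deletions-reverse v) ⟨
      map g (map σ (map reverse (deletions v)))
        ≡⟨ map-∘ _ ⟨
      map (λ u → g (σ u)) (map reverse (deletions v))
        ≡⟨ map-∘ (deletions v) ⟨
      map (λ u → g (σ (reverse u))) (deletions v)
        ≡⟨ map-cong-local (All.zipWith same
             (linked-deletions (λ p q → <-trans q p) d , length-deletions v)) ⟨
      map L (deletions v)
        ≡⟨ cong (map L) e ⟩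
      map L (ds ∷ʳ y)
        ≡⟨ map-++ L ds _ ⟩
      map L ds ∷ʳ L y
        ∎
      where
      same : ∀ {u} → Dec u × suc (length u) ≡ suc (length w) → L u ≡ g (σ (reverse u))
      same (d , k) with refl ← trans (suc-injective k) m = lift-dec σ d 2≤r

  -- Except at an initial valley, the tail and the first merge have equal colours, which for a
  -- longer run is the colour of the run shortened by one; the remaining merges then follow the
  -- patterns above.
  zig-colours : ∀ {a w z} → Proper (a ∷ w) → Zig (a ∷ w) z → length w ≡ r →
    Monotone (map L (w ∷ merges (a ∷ w)))
  zig-colours {a} {b ∷ c ∷ w} pr (peak p q) m rewrite m≤n⇒m⊔n≡n (<⇒≤ p) =
    go (top q (proper-tail (proper-tail pr)))
    where
    go : ∀ {l} → Top b (c ∷ w) l → Monotone (L (b ∷ c ∷ w) ∷ L (b ∷ c ∷ w) ∷ map L (map (a ∷_) l))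
    go (all ds) = _ , true , refl ∷ refl ∷
      rest (colours (λ z → z) (All.map⁺ (All.map (λ { (u , w , refl , t) → peak p t }) ds)))
    go (pair v) = _ , _ , refl ∷ refl ∷ rest (refl ∷ refl ∷ [])
    go (twin v s ds) = false , true , lift-zig σ s ∷ lift-zig σ s ∷ seg-twin _
      (colours (λ z → z) (All.map⁺ (All.map (λ { (u , w , refl , t) → peak p t }) ds)))
  zig-colours {a} {b ∷ c ∷ w} pr (up p q s) m
    rewrite m≤n⇒m⊔n≡n (<⇒≤ p) =
    _ , _ , lift-zig σ s ∷ lift-zig σ s ∷ pattern-colours (λ _ _ ())
      (All.map⁺ (All.map (λ e → trans e m) (length-merges (b ∷ c ∷ w))))
      (pattern-up p q (proper-tail pr) s)
  zig-colours {a} {b ∷ c ∷ w} pr (down p q s) m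
    rewrite m≥n⇒m⊔n≡m (<⇒≤ p) =
    _ , _ , lift-zig σ s ∷ lift-zig σ (zig-head s q (<-trans q p)) ∷ pattern-colours lowered-colours
      (All.map⁺ (All.map (λ e → trans e m) (length-merges (b ∷ c ∷ w))))
      (pattern-down p q (proper-tail pr) s)
  -- The words are `b c`, then `a c` twice, then `a b`: a rise, a pair of either colour, and a fall.
  zig-colours {a} {b ∷ c ∷ []} pr (valley p q) refl
    rewrite m≥n⇒m⊔n≡m (<⇒≤ p) | m≤n⇒m⊔n≡n (<⇒≤ q)
          | lift-inc σ (q ∷ [-]) | pairs refl (b ∷ c ∷ [])
          | lift-dec σ (p ∷ [-]) ≤-refl | pairs refl (b ∷ a ∷ []) =
    true , false , refl ∷ seg-twin _ (refl ∷ [])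
  zig-colours {a} {b ∷ c ∷ d ∷ w} (cons _ n pr′) (valley p q) m
    rewrite m≥n⇒m⊔n≡m (<⇒≤ p) | m≤n⇒m⊔n≡n (<⇒≤ q) = go (<-cmp c d) (<-cmp a c)
    where
    tails : All (_≡ false) (map L (map (a ∷_) (map (b ∷_) (merges (c ∷ d ∷ w)))))
    tails = colours (λ z → z) (All.map⁺ (All.map⁺ (All.map
      (λ { (u , w , refl , t) → valley p (<-≤-trans q t) }) (head-merges c d w))))
    goal = Monotone (L (b ∷ c ∷ d ∷ w) ∷ L (a ∷ c ∷ d ∷ w) ∷ L (a ∷ c ∷ d ∷ w) ∷
      map L (map (a ∷_) (map (b ∷_) (merges (c ∷ d ∷ w)))))
    go : _ → _ → goal
    go (tri≈ _ e _) _ = contradiction e (proper-≢ (proper-tail pr′))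
    go _ (tri≈ _ e _) = contradiction e n
    go (tri> _ _ t) _ = true , false , lift-zig σ (peak q t) ∷ seg-twin _ tails
    go (tri< t _ _) (tri> _ _ u) =
      _ , false , refl ∷ rest (lift-zig σ (valley u t) ∷ lift-zig σ (valley u t) ∷ tails)
    go (tri< t _ _) (tri< u _ _) with shape (proper-tail pr′)
    -- Both words are increasing and differ in the first letter only. As `b < a`, the colour can
    -- only fall from one to the next, which suits the block of `false` behind them.
    ... | inc i rewrite lift-inc σ (q ∷ i) | lift-inc σ (u ∷ i) =
      true , false , seg-falling (not-mono (first-≤ p (q ∷ i) (u ∷ i) m)) tails
    ... | dec (v ∷ _) = contradiction v (<-asym t)
    ... | zig s rewrite lift-zig σ (up q t s) | lift-zig σ (up u t s) =
      _ , false , refl ∷ refl ∷ refl ∷ rest tails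

  proper-colours : ∀ {a w} → Proper (a ∷ w) → length w ≡ r →
    Monotone (map L (w ∷ merges (a ∷ w)))
  proper-colours pr k with shape pr
  ... | inc i = inc-colours i k
  ... | dec d = dec-colours d k
  ... | zig s = zig-colours pr s k

  lift-monotone : ∀ {w} → Inc w → length w ≡ suc (suc r) →
    Monotone (map (λ v → lift σ (gaps v)) (deletions w))
  lift-monotone {x ∷ y ∷ w} i m =
    subst Monotone
      (trans (cong (map L) (sym (gaps-deletions w i))) (sym (map-∘ (deletions (x ∷ y ∷ w)))))
      (proper-colours (gaps-proper i) (trans (length-gaps y w) (suc-injective (suc-injective m))))

-- Monotonicity in the first and in the last letter.

trichotomy : ∀ {w} → Proper w → Inc w ⊎ Dec w ⊎ ∃ (Zig w)
trichotomy pr with shape pr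
... | inc i = inj₁ i
... | dec d = inj₂ (inj₁ d)
... | zig s = inj₂ (inj₂ (_ , s))

zig-++ : ∀ {w z} v → Zig w z → Zig (w ++ v) z
zig-++ v (peak p q)   = peak p q
zig-++ v (valley p q) = valley p q
zig-++ v (up p q s)   = up p q (zig-++ v s)
zig-++ v (down p q s) = down p q (zig-++ v s)

zig-peakʳ : ∀ {b c a} w → Inc (a ∷ w ∷ʳ b) → c < b → Zig (a ∷ w ∷ʳ b ∷ʳ c) (even (length w))
zig-peakʳ []          (p ∷ _) q = peak p q
zig-peakʳ (_ ∷ [])    (p ∷ i@(r ∷ _)) q = up p r (zig-peakʳ [] i q)
zig-peakʳ (_ ∷ x ∷ w) (p ∷ i@(r ∷ _)) q = up p r (zig-peakʳ (x ∷ w) i q)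

zig-valleyʳ : ∀ {b c a} w → Dec (a ∷ w ∷ʳ b) → b < c → Zig (a ∷ w ∷ʳ b ∷ʳ c) (not (even (length w)))
zig-valleyʳ []          (p ∷ _) q = valley p q
zig-valleyʳ (_ ∷ [])    (p ∷ i@(r ∷ _)) q = down p r (zig-valleyʳ [] i q)
zig-valleyʳ (_ ∷ x ∷ w) (p ∷ i@(r ∷ _)) q = down p r (zig-valleyʳ (x ∷ w) i q)

xor-not : ∀ x y → (not x xor not y) ≡ (x xor y)
xor-not true  y = refl
xor-not false y = Bool.not-involutive y

xor-cancel : ∀ x y → (not x xor not (x xor y)) ≡ y
xor-cancel true  y = Bool.not-involutive y
xor-cancel false y = Bool.not-involutive y

module _ {r : ℕ} {σ : Word → Bool} (S : Signotope r σ) where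
  open Signotope S

  private
    L = lift σ

  -- If `a` and `b` lie on the same side of `c`, both words have the same shape, and either the
  -- colours agree or the old colouring decides. The order is reversed because raising the first
  -- vertex can only lower the first gap.
  lift-first : ∀ {a b c w} → b < a → a ≢ c → b ≢ c → Proper (c ∷ w) → suc (suc (length w)) ≡ r →
    L (a ∷ c ∷ w) ≤ᵇ L (b ∷ c ∷ w)
  lift-first {a} {b} {c} {w} b<a a≢c b≢c pr m = go (<-cmp a c) (<-cmp b c) w pr m
    where
    same : ∀ {v v′ z} → Zig v z → Zig v′ z → L v ≤ᵇ L v′
    same s t = Bool.≤-reflexive (trans (lift-zig σ s) (sym (lift-zig σ t)))
    decs : ∀ {w} → Dec (a ∷ c ∷ w) → Dec (b ∷ c ∷ w) → suc (suc (length w)) ≡ r →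
      L (a ∷ c ∷ w) ≤ᵇ L (b ∷ c ∷ w)
    decs {w} d d′ refl rewrite lift-dec σ d (s≤s (s≤s z≤n)) | lift-dec σ d′ (s≤s (s≤s z≤n))
      | unfold-reverse a (c ∷ w) | unfold-reverse b (c ∷ w) =
      not-mono (last-≤ (reverse (c ∷ w)) b<a
        (subst Inc (unfold-reverse b (c ∷ w)) (linked-reverse d′))
        (subst Inc (unfold-reverse a (c ∷ w)) (linked-reverse d))
        (cong suc (length-reverse (c ∷ w))))
    go : _ → _ → ∀ w → Proper (c ∷ w) → suc (suc (length w)) ≡ r → L (a ∷ c ∷ w) ≤ᵇ L (b ∷ c ∷ w)
    go (tri≈ _ e _) _ _ _ _ = contradiction e a≢c
    go _ (tri≈ _ e _) _ _ _ = contradiction e b≢c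
    go (tri< p _ _) (tri> _ _ q) _ _ _ = contradiction b<a (<-asym (<-trans p q))
    go (tri< p _ _) (tri< q _ _) w pr m with shape pr
    ... | inc i rewrite lift-inc σ (p ∷ i) | lift-inc σ (q ∷ i) =
      not-mono (first-≤ b<a (q ∷ i) (p ∷ i) m)
    ... | dec (s ∷ _) = same (peak p s) (peak q s)
    ... | zig z = ziggy z
      where
      ziggy : ∀ {w z} → Zig (c ∷ w) z → L (a ∷ c ∷ w) ≤ᵇ L (b ∷ c ∷ w)
      ziggy s@(peak t _)   = same (up p t s) (up q t s)
      ziggy s@(up t _ _)   = same (up p t s) (up q t s)
      ziggy (valley t _)   = same (peak p t) (peak q t)
      ziggy (down t _ _)   = same (peak p t) (peak q t)
    go (tri> _ _ p) (tri> _ _ q) w pr m with shape pr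
    ... | inc [-] = decs (p ∷ [-]) (q ∷ [-]) m
    ... | inc (s ∷ _) = same (valley p s) (valley q s)
    ... | dec d = decs (p ∷ d) (q ∷ d) m
    ... | zig z = ziggy z
      where
      ziggy : ∀ {w z} → Zig (c ∷ w) z → L (a ∷ c ∷ w) ≤ᵇ L (b ∷ c ∷ w)
      ziggy s@(valley t _) = same (down p t s) (down q t s)
      ziggy s@(down t _ _) = same (down p t s) (down q t s)
      ziggy (peak t _)     = same (valley p t) (valley q t)
      ziggy (up t _ _)     = same (valley p t) (valley q t)
    go (tri> _ _ p) (tri< q _ _) [] _ refl
      rewrite lift-dec σ (p ∷ [-]) ≤-refl | pairs refl (c ∷ a ∷ []) = Bool.≤-minimum _
    -- Only one word turns at `c`: a rise to `d` makes a valley after `a`, the least colour, and a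
    -- fall makes a peak after `b`, the greatest.
    go (tri> _ _ p) (tri< q _ _) (d ∷ w) pr m with <-cmp c d
    ... | tri< s _ _ rewrite lift-zig σ {a ∷ c ∷ d ∷ w} (valley p s) = Bool.≤-minimum _
    ... | tri≈ _ e _ = contradiction e (proper-≢ pr)
    ... | tri> _ _ s rewrite lift-zig σ {b ∷ c ∷ d ∷ w} (peak q s) = Bool.≤-maximum _

  private
    infix 4 _⊑_
    _⊑_ : Word → Word → Set
    v ⊑ v′ = (not (even r) xor L v) ≤ᵇ (not (even r) xor L v′)

    ⊑-zig : ∀ {v v′ z} → Zig v z → Zig v′ z → v ⊑ v′
    ⊑-zig s t = Bool.≤-reflexive
      (cong (not (even r) xor_) (trans (lift-zig σ s) (sym (lift-zig σ t))))

    ⊑-inc : ∀ {a b} w → a < b → Inc (w ∷ʳ a) → Inc (w ∷ʳ b) → suc (length w) ≡ r → w ∷ʳ a ⊑ w ∷ʳ b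
    ⊑-inc {a} {b} w a<b i j m rewrite lift-inc σ i | lift-inc σ j
      | xor-not (even r) (σ (w ∷ʳ a)) | xor-not (even r) (σ (w ∷ʳ b)) = last-≤ w a<b i j m

    ⊑-dec : ∀ {a b} w → a < b → Dec (w ∷ʳ a) → Dec (w ∷ʳ b) → suc (length w) ≡ r → 2 ≤ r →
      w ∷ʳ a ⊑ w ∷ʳ b
    ⊑-dec {a} {b} w a<b i j m 2≤r
      rewrite lift-dec σ i (subst (2 ≤_) (sym (trans (length-∷ʳ w a) m)) 2≤r)
            | lift-dec σ j (subst (2 ≤_) (sym (trans (length-∷ʳ w b) m)) 2≤r)
            | trans (length-∷ʳ w a) m | trans (length-∷ʳ w b) m
            | xor-cancel (even r) (σ (reverse (w ∷ʳ a)))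
            | xor-cancel (even r) (σ (reverse (w ∷ʳ b)))
            | reverse-∷ʳ w a | reverse-∷ʳ w b =
      first-≤ a<b (subst Inc (reverse-∷ʳ w a) (linked-reverse i))
        (subst Inc (reverse-∷ʳ w b) (linked-reverse j))
        (trans (cong suc (length-reverse w)) m)

  lift-last : ∀ {a b c} w → a < b → a ≢ c → b ≢ c → Proper (w ∷ʳ c) → suc (suc (length w)) ≡ r →
    w ∷ʳ c ∷ʳ a ⊑ w ∷ʳ c ∷ʳ b
  lift-last {a} {b} {c} w a<b a≢c b≢c pr m = go (<-cmp a c) (<-cmp b c) w (trichotomy pr) m
    where
    suc-∷ʳ : ∀ w → suc (suc (length w)) ≡ r → suc (length (w ∷ʳ c)) ≡ r
    suc-∷ʳ w m = trans (cong suc (length-∷ʳ w c)) m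
    go : _ → _ → ∀ w → Inc (w ∷ʳ c) ⊎ Dec (w ∷ʳ c) ⊎ ∃ (Zig (w ∷ʳ c)) → suc (suc (length w)) ≡ r →
      w ∷ʳ c ∷ʳ a ⊑ w ∷ʳ c ∷ʳ b
    go (tri≈ _ e _) _ _ _ _ = contradiction e a≢c
    go _ (tri≈ _ e _) _ _ _ = contradiction e b≢c
    go (tri> _ _ p) (tri< q _ _) _ _ _ = contradiction a<b (<-asym (<-trans q p))
    go _ _ w (inj₂ (inj₂ (_ , s))) _ = ⊑-zig (zig-++ (a ∷ []) s) (zig-++ (b ∷ []) s)
    go (tri< p _ _) (tri< q _ _) [] _ m@refl =
      ⊑-dec (c ∷ []) a<b (p ∷ [-]) (q ∷ [-]) m (s≤s (s≤s z≤n))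
    go (tri> _ _ p) (tri> _ _ q) [] _ m = ⊑-inc (c ∷ []) a<b (p ∷ [-]) (q ∷ [-]) m
    go (tri< p _ _) (tri> _ _ q) [] _ refl
      rewrite lift-dec σ (p ∷ [-]) ≤-refl | pairs refl (a ∷ c ∷ []) = Bool.≤-minimum _
    go (tri< p _ _) (tri< q _ _) (x ∷ w) (inj₁ i) _ = ⊑-zig (zig-peakʳ w i p) (zig-peakʳ w i q)
    go (tri> _ _ p) (tri> _ _ q) w@(_ ∷ _) (inj₁ i) m =
      ⊑-inc (w ∷ʳ c) a<b (linked-∷ʳ w i p) (linked-∷ʳ w i q) (suc-∷ʳ w m)
    -- The word ending in `a` turns at `c`, so its run length is fixed by `r`, and the parity factor
    -- makes its value the least one. In the decreasing case below, the word ending in `b` gets the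
    -- greatest.
    go (tri< p _ _) (tri> _ _ q) (x ∷ w) (inj₁ i) refl
      rewrite lift-zig σ (zig-peakʳ w i p) with even (length w)
    ... | true  = Bool.≤-minimum _
    ... | false = Bool.≤-minimum _
    go (tri< p _ _) (tri< q _ _) w@(_ ∷ _) (inj₂ (inj₁ d)) m@refl =
      ⊑-dec (w ∷ʳ c) a<b (linked-∷ʳ w d p) (linked-∷ʳ w d q) (suc-∷ʳ w m) (s≤s (s≤s z≤n))
    go (tri> _ _ p) (tri> _ _ q) (x ∷ w) (inj₂ (inj₁ d)) _ =
      ⊑-zig (zig-valleyʳ w d p) (zig-valleyʳ w d q)
    go (tri< p _ _) (tri> _ _ q) (x ∷ w) (inj₂ (inj₁ d)) refl
      rewrite lift-zig σ (zig-valleyʳ w d q) with even (length w)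
    ... | true  = Bool.≤-maximum _
    ... | false = Bool.≤-maximum _

-- Stepping up from one uniformity to the next.

gaps-∷ʳ : ∀ w x y → gaps (w ∷ʳ x ∷ʳ y) ≡ gaps (w ∷ʳ x) ∷ʳ δ x y
gaps-∷ʳ []          x y = refl
gaps-∷ʳ (a ∷ [])    x y = refl
gaps-∷ʳ (a ∷ b ∷ w) x y = cong (δ a b ∷_) (gaps-∷ʳ (b ∷ w) x y)

length-gaps-∷ʳ : ∀ w x → length (gaps (w ∷ʳ x)) ≡ length w
length-gaps-∷ʳ []      x = refl
length-gaps-∷ʳ (a ∷ w) x = trans (length-gaps a (w ∷ʳ x)) (length-∷ʳ w x)

constant : Signotope 2 (λ _ → false)
constant = record
  { monotone = λ {w} _ _ → false , false ,
                 rest (All.map⁺ (All.universal (λ _ → refl) (deletions w)))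
  ; first-≤  = λ _ _ _ _ → b≤b
  ; last-≤   = λ _ _ _ _ _ → b≤b
  ; pairs    = λ _ _ → refl
  }

stepUp : ∀ {r σ} → 2 ≤ r → Signotope r σ → Signotope (suc r) (λ v → lift σ (gaps v))
stepUp {r} {σ} 2≤r S = record
  { monotone = lift-monotone S 2≤r
  ; first-≤  = first
  ; last-≤   = last
  ; pairs    = λ { refl → contradiction 2≤r λ { (s≤s ()) } }
  }
  where
  L = lift σ
  first : ∀ {a b w} → a < b → Inc (a ∷ w) → Inc (b ∷ w) → suc (length w) ≡ suc r →
    L (gaps (a ∷ w)) ≤ᵇ L (gaps (b ∷ w))
  first {w = []} _ _ _ refl = contradiction 2≤r λ ()
  first {w = _ ∷ []} _ _ _ refl = contradiction 2≤r λ { (s≤s ()) }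
  first {a} {b} {c ∷ d ∷ w} p i@(q ∷ s ∷ _) j@(q′ ∷ k) m with <-cmp (δ a b) (δ b c)
  -- The larger gap lies beyond `b`, so `a` and `b` see the same gap to `c` and the words coincide.
  ... | tri< t _ _ = Bool.≤-reflexive (cong (λ x → L (x ∷ gaps (c ∷ d ∷ w)))
    (trans (δ-⊔ p q′) (m≤n⇒m⊔n≡n (<⇒≤ t))))
  ... | tri≈ _ e _ = contradiction e (δ-≢ p q′)
  ... | tri> _ _ t = subst (λ x → L (x ∷ gaps (c ∷ d ∷ w)) ≤ᵇ L (gaps (b ∷ c ∷ d ∷ w))) (sym eq)
    (lift-first S t (λ e → δ-≢ q s (trans eq e)) (δ-≢ q′ s) (gaps-proper k)
      (trans (cong (λ n → suc (suc n)) (length-gaps d w)) (suc-injective m)))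
    where
    eq : δ a c ≡ δ a b
    eq = trans (δ-⊔ p q′) (m≥n⇒m⊔n≡m (<⇒≤ t))
  last : ∀ {a b} w → a < b → Inc (w ∷ʳ a) → Inc (w ∷ʳ b) → suc (length w) ≡ suc r →
    (not (even r) xor L (gaps (w ∷ʳ a))) ≤ᵇ (not (even r) xor L (gaps (w ∷ʳ b)))
  last w p i j m with initLast w
  last _ p i j refl | [] = contradiction 2≤r λ ()
  last _ p i j m | w ∷ʳ′ c with initLast w
  last _ p i j refl | _ | [] = contradiction 2≤r λ { (s≤s ()) }
  last {a} {b} _ p i j m | _ ∷ʳ′ c | w ∷ʳ′ d
    rewrite gaps-∷ʳ (w ∷ʳ d) c a | gaps-∷ʳ (w ∷ʳ d) c b | gaps-∷ʳ w d c
    with k , c<b ← linked-∷ʳ⁻ (w ∷ʳ d) j | _ , c<a ← linked-∷ʳ⁻ (w ∷ʳ d) i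
    with _ , d<c ← linked-∷ʳ⁻ w k | <-cmp (δ c a) (δ a b)
  ... | tri≈ _ e _ = contradiction e (δ-≢ c<a p)
  ... | tri> _ _ t = Bool.≤-reflexive (cong (λ x → not (even r) xor L (gaps (w ∷ʳ d) ∷ʳ δ d c ∷ʳ x))
    (sym (trans (δ-⊔ c<a p) (m≥n⇒m⊔n≡m (<⇒≤ t)))))
  ... | tri< t _ _ = lift-last S (gaps (w ∷ʳ d)) (subst (δ c a <_) (sym eq) t)
    (λ e → δ-≢ d<c c<a (sym e)) (λ e → δ-≢ d<c c<b (sym e))
    (subst Proper (gaps-∷ʳ w d c) (gaps-proper k))
    (begin
      suc (suc (length (gaps (w ∷ʳ d))))  ≡⟨ cong (λ n → suc (suc n)) (length-gaps-∷ʳ w d) ⟩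
      suc (suc (length w))                ≡⟨ cong suc (length-∷ʳ w d) ⟨
      suc (length (w ∷ʳ d))               ≡⟨ length-∷ʳ (w ∷ʳ d) c ⟨
      length (w ∷ʳ d ∷ʳ c)                ≡⟨ suc-injective m ⟩
      r                                   ∎)
    where
    open ≡-Reasoning
    eq : δ c b ≡ δ a b
    eq = trans (δ-⊔ c<a p) (m≤n⇒m⊔n≡n (<⇒≤ t))

-- Monochromatic paths and their gap words.

record Monochromatic (r : ℕ) (c : Word → Bool) (z : Bool) (w : Word) : Set where
  constructor mono
  field
    colour : ∀ p v s → w ≡ p ++ v ++ s → length v ≡ r → c v ≡ z

open Monochromatic

PathBound : (r V B : ℕ) → (Word → Bool) → Set
PathBound r V B c = ∀ {w z} → Inc w → All (_< V) w → Monochromatic r c z w → length w ≤ B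

mono-infix : ∀ {r c z} p {w} s → Monochromatic r c z (p ++ w ++ s) → Monochromatic r c z w
mono-infix p {w} s m .colour p′ v s′ refl = m .colour (p ++ p′) v (s′ ++ s) (begin
  p ++ (p′ ++ v ++ s′) ++ s  ≡⟨ cong (p ++_) (++-assoc p′ (v ++ s′) s) ⟩
  p ++ p′ ++ (v ++ s′) ++ s  ≡⟨ cong (λ t → p ++ p′ ++ t) (++-assoc v s′ s) ⟩
  p ++ p′ ++ v ++ s′ ++ s    ≡⟨ ++-assoc p p′ _ ⟨
  (p ++ p′) ++ v ++ s′ ++ s  ∎)
  where open ≡-Reasoning

mono-tail : ∀ {r c z a w} → Monochromatic r c z (a ∷ w) → Monochromatic r c z w
mono-tail {a = a} m .colour p v s e = m .colour (a ∷ p) v s (cong (a ∷_) e)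

gaps-split : ∀ a v {w s} → gaps (a ∷ w) ≡ v ++ s →
  ∃₂ λ v′ s′ → w ≡ v′ ++ s′ × length v′ ≡ length v × gaps (a ∷ v′) ≡ v
gaps-split a [] e = [] , _ , refl , refl , refl
gaps-split a (x ∷ v) {b ∷ w} e with ∷-injective e
... | refl , f with v′ , s′ , g , h , i ← gaps-split b v f =
  b ∷ v′ , s′ , cong (b ∷_) g , cong suc h , cong (δ a b ∷_) i

-- Every window of the gap word comes from a window of the path with one more vertex, so gap words
-- of monochromatic paths are monochromatic for `lift`.
gaps-infix : ∀ p a v {w s} → gaps w ≡ p ++ (a ∷ v) ++ s →
  ∃₂ λ p′ v′ → ∃ λ s′ → w ≡ p′ ++ v′ ++ s′ × length v′ ≡ suc (suc (length v)) × gaps v′ ≡ a ∷ v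
gaps-infix [] a v {x ∷ w} e with v′ , s′ , f , g , h ← gaps-split x (a ∷ v) {w} e =
  [] , x ∷ v′ , s′ , cong (x ∷_) f , cong suc g , h
gaps-infix (_ ∷ p) a v {x ∷ y ∷ w} e
  with p′ , v′ , s′ , f , g ← gaps-infix p a v {y ∷ w} (∷-injectiveʳ e) =
  x ∷ p′ , v′ , s′ , cong (x ∷_) f , g

mono-gaps : ∀ {r c z w} → Monochromatic (suc (suc r)) (λ v → c (gaps v)) z w →
  Monochromatic (suc r) c z (gaps w)
mono-gaps {c = c} m .colour p (a ∷ v) s e l with p′ , v′ , s′ , f , g , h ← gaps-infix p a v e =
  trans (cong c (sym h)) (m .colour p′ v′ s′ f (trans g (cong suc l)))

linked-++⁻ˡ : ∀ {R : ℕ → ℕ → Set} v {s} → Linked R (v ++ s) → Linked R v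
linked-++⁻ˡ []          _       = []
linked-++⁻ˡ (_ ∷ [])    _       = [-]
linked-++⁻ˡ (_ ∷ b ∷ v) (p ∷ l) = p ∷ linked-++⁻ˡ (b ∷ v) l

linked-++⁻ʳ : ∀ {R : ℕ → ℕ → Set} p {v} → Linked R (p ++ v) → Linked R v
linked-++⁻ʳ []      l = l
linked-++⁻ʳ (_ ∷ p) l = linked-++⁻ʳ p (Linked.tail l)

-- Monotone stretches of a gap word are paths of the old colouring.

module _ {r V B : ℕ} {σ : Word → Bool} (2≤r : 2 ≤ r) (bound : PathBound r V B σ) where

  inc-bound : ∀ {w z} → Inc w → All (_< V) w → Monochromatic r (lift σ) z w → length w ≤ B
  inc-bound {w} {z} i a m = bound {z = not z} i a (mono λ { p v s refl l →
    trans (sym (Bool.not-involutive _)) (cong not (trans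
      (sym (lift-inc σ (linked-++⁻ˡ v (linked-++⁻ʳ p i)))) (m .colour p v s refl l))) })

  dec-bound : ∀ {w z} → Dec w → All (_< V) w → Monochromatic r (lift σ) z w → length w ≤ B
  dec-bound {w} {z} d a m = subst (_≤ B) (length-reverse w)
    (bound {z = even r xor not z} (linked-reverse d) (All-reverse a) (mono go))
    where
    All-reverse : ∀ {w} → All (_< V) w → All (_< V) (reverse w)
    All-reverse [] = []
    All-reverse {b ∷ w} (p ∷ ps) rewrite unfold-reverse b w = All.∷ʳ⁺ (All-reverse ps) p
    unxor : ∀ x {y z} → not (x xor y) ≡ z → y ≡ x xor not z
    unxor true  {y} refl = sym (trans (Bool.not-involutive _) (Bool.not-involutive y))
    unxor false {y} refl = sym (Bool.not-involutive y)
    flip : ∀ p v s → reverse w ≡ p ++ v ++ s → w ≡ reverse s ++ reverse v ++ reverse p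
    flip p v s e = begin
      w                                    ≡⟨ reverse-involutive w ⟨
      reverse (reverse w)                  ≡⟨ cong reverse e ⟩
      reverse (p ++ v ++ s)                ≡⟨ reverse-++ p (v ++ s) ⟩
      reverse (v ++ s) ++ reverse p        ≡⟨ cong (_++ reverse p) (reverse-++ v s) ⟩
      (reverse s ++ reverse v) ++ reverse p ≡⟨ ++-assoc (reverse s) _ _ ⟩
      reverse s ++ reverse v ++ reverse p  ∎
      where open ≡-Reasoning
    go : ∀ p v s → reverse w ≡ p ++ v ++ s → length v ≡ r → σ v ≡ even r xor not z
    go p v s e refl
      with m .colour (reverse s) (reverse v) (reverse p) (flip p v s e) (length-reverse v)
    ... | eq rewrite lift-dec σ
      (linked-++⁻ˡ (reverse v) (linked-++⁻ʳ (reverse s) (subst Dec (flip p v s e) d)))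
      (subst (2 ≤_) (sym (length-reverse v)) 2≤r) | length-reverse v | reverse-involutive v =
      unxor (even (length v)) eq

  pure-bound : ∀ {w z} p q t → w ≡ p ++ q ++ t → Inc q ⊎ Dec q → All (_< V) w →
    Monochromatic r (lift σ) z w → length q ≤ B
  pure-bound p q t refl i a m with All.++⁻ˡ q (All.++⁻ʳ p a)
  pure-bound p q t refl (inj₁ i) a m | a′ = inc-bound i a′ (mono-infix p t m)
  pure-bound p q t refl (inj₂ d) a m | a′ = dec-bound d a′ (mono-infix p t m)

proper-++⁻ˡ : ∀ v {s} → Proper (v ++ s) → Proper v
proper-++⁻ˡ []              _            = []
proper-++⁻ˡ (_ ∷ [])        _            = [-]
proper-++⁻ˡ (_ ∷ _ ∷ [])    p            = pair (proper-≢ p)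
proper-++⁻ˡ (_ ∷ b ∷ c ∷ v) (cons n m p) = cons n m (proper-++⁻ˡ (b ∷ c ∷ v) p)

-- Windows of two letters: no change of direction.

module _ {σ : Word → Bool} (pairs : ∀ w → σ w ≡ false) where

  rise-true : ∀ {a b} → a < b → lift σ (a ∷ b ∷ []) ≡ true
  rise-true {a} {b} p rewrite lift-inc σ (p ∷ [-]) | pairs (a ∷ b ∷ []) = refl

  fall-false : ∀ {a b} → a > b → lift σ (a ∷ b ∷ []) ≡ false
  fall-false {a} {b} p rewrite lift-dec σ (p ∷ [-]) ≤-refl | pairs (b ∷ a ∷ []) = refl

  pure₂ : ∀ {z w} → Proper w → Monochromatic 2 (lift σ) z w → Inc w ⊎ Dec w
  pure₂ [] m = inj₁ []
  pure₂ [-] m = inj₁ [-]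
  pure₂ (pair {a} {b} n) m with <-cmp a b
  ... | tri< p _ _ = inj₁ (p ∷ [-])
  ... | tri≈ _ e _ = contradiction e n
  ... | tri> _ _ p = inj₂ (p ∷ [-])
  pure₂ {z} (cons {a} {b} {c} {w} n _ pr) m with <-cmp a b | pure₂ pr (mono-tail m)
  ... | tri≈ _ e _ | _ = contradiction e n
  ... | tri< p _ _ | inj₁ i = inj₁ (p ∷ i)
  ... | tri> _ _ p | inj₂ d = inj₂ (p ∷ d)
  ... | tri< p _ _ | inj₂ (q ∷ _) = contradiction
    (trans (sym (rise-true p)) (trans (m .colour [] _ _ refl refl)
      (trans (sym (m .colour (a ∷ []) (b ∷ c ∷ []) w refl refl)) (fall-false q)))) λ ()
  ... | tri> _ _ p | inj₁ (q ∷ _) = contradiction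
    (trans (sym (fall-false p)) (trans (m .colour [] _ _ refl refl)
      (trans (sym (m .colour (a ∷ []) (b ∷ c ∷ []) w refl refl)) (rise-true q)))) λ ()

-- Windows of three letters: one change of direction.

module _ {R S : ℕ → ℕ → Set} (total : ∀ {a b} → a ≢ b → R a b ⊎ S a b) where

  NoTurn : Word → Set
  NoTurn w = ∀ p {a b c} s → w ≡ p ++ a ∷ b ∷ c ∷ s → S a b → R b c → ⊥

  noTurn-tail : ∀ {a w} → NoTurn (a ∷ w) → NoTurn w
  noTurn-tail {a} n p s e = n (a ∷ p) s (cong (a ∷_) e)

  one-turn : ∀ {w} → Proper w → NoTurn w → ∃₂ λ p s → w ≡ p ++ s × Linked R p × Linked S s
  one-turn [] _ = [] , [] , refl , [] , []
  one-turn [-] _ = [] , _ , refl , [] , [-]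
  one-turn (pair {a} {b} n) _ = a ∷ [] , b ∷ [] , refl , [-] , [-]
  one-turn (cons {a} {b} {c} n _ pr) t with total n | one-turn pr (noTurn-tail t)
  ... | inj₁ r | [] , s , e , i , j = a ∷ [] , s , cong (a ∷_) e , [-] , j
  ... | inj₁ r | x ∷ p , s , e , i , j with refl ← ∷-injectiveˡ e =
    a ∷ b ∷ p , s , cong (a ∷_) e , r ∷ i , j
  ... | inj₂ q | _ = [] , _ , refl , [] , q ∷ falling q t pr
    where
    falling : ∀ {a b w} → S a b → NoTurn (a ∷ b ∷ w) → Proper (b ∷ w) → Linked S (b ∷ w)
    falling q t [-] = [-]
    falling q t (pair n) with total n
    ... | inj₁ r = contradiction (t [] [] refl q r) λ ()
    ... | inj₂ q′ = q′ ∷ [-]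
    falling q t (cons n _ pr) with total n
    ... | inj₁ r = contradiction (t [] _ refl q r) λ ()
    ... | inj₂ q′ = q′ ∷ falling q′ (noTurn-tail t) pr

≢⇒<⊎> : ∀ {a b} → a ≢ b → a < b ⊎ a > b
≢⇒<⊎> {a} {b} n with <-cmp a b
... | tri< p _ _ = inj₁ p
... | tri≈ _ e _ = contradiction e n
... | tri> _ _ p = inj₂ p

≢⇒>⊎< : ∀ {a b} → a ≢ b → a > b ⊎ a < b
≢⇒>⊎< n with ≢⇒<⊎> n
... | inj₁ p = inj₂ p
... | inj₂ p = inj₁ p

-- Windows of four or more letters: turns only near the ends.

module _ {r : ℕ} {σ : Word → Bool} {z : Bool} (4≤r : 4 ≤ r) where

  private
    clash : ∀ {w p v s p′ v′ s′ y} → Monochromatic r (lift σ) z w →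
      w ≡ p ++ v ++ s → w ≡ p′ ++ v′ ++ s′ → length v ≡ r → length v′ ≡ r →
      Zig v (not y) → Zig v′ y → ⊥
    clash {p = p} {v} {s} {p′} {v′} {s′} m e e′ l l′ t t′ = Bool.not-¬ refl
      (trans (sym (lift-zig σ t′)) (trans (m .colour p′ v′ s′ e′ l′)
        (trans (sym (m .colour p v s e l)) (lift-zig σ t))))

  module _ {R : ℕ → ℕ → Set}
    (grow : ∀ {b c d w y} → R b c → R c d → Zig (c ∷ d ∷ w) y → Zig (b ∷ c ∷ d ∷ w) (not y))
    (extend : ∀ {c d w e} → Linked R (c ∷ d ∷ w) → Proper (c ∷ d ∷ w ∷ʳ e) →
      Linked R (c ∷ d ∷ w ∷ʳ e) ⊎ ∃ (Zig (c ∷ d ∷ w ∷ʳ e)))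
    where

    -- If the run stops at `e`, the windows starting at the second and third letters both contain
    -- the turn, with run lengths differing by one and hence opposite colours. The latter window
    -- needs a letter beyond `e`, so only the final letter can escape.
    pure-window : ∀ v e s → length v ≡ r → Linked R v → Proper (v ++ e ∷ s) →
      Monochromatic r (lift σ) z (v ++ e ∷ s) →
      ∃₂ λ s₁ t → e ∷ s ≡ s₁ ++ t × Linked R (v ++ s₁) × length t ≤ 1
    pure-window v e [] _ i _ _ =
      [] , e ∷ [] , refl , subst (Linked R) (sym (++-identityʳ v)) i , ≤-refl
    pure-window (a ∷ b ∷ c ∷ d ∷ v) e (f ∷ s) l (p ∷ q ∷ i@(q′ ∷ _)) pr m
      with extend i (proper-++⁻ˡ (c ∷ d ∷ v ∷ʳ e)
        (subst Proper (sym (++-assoc (c ∷ d ∷ v) (e ∷ []) (f ∷ s))) (proper-tail (proper-tail pr))))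
    ... | inj₂ (y , s′) = contradiction (clash {p = a ∷ []} {p′ = a ∷ b ∷ []} m
        (cong (λ t → a ∷ b ∷ c ∷ d ∷ t) (sym (++-assoc v (e ∷ []) (f ∷ s))))
        (cong (λ t → a ∷ b ∷ c ∷ d ∷ t)
          (trans (sym (++-assoc v (e ∷ []) (f ∷ s))) (sym (++-assoc (v ∷ʳ e) (f ∷ []) s))))
        (trans (cong (λ n → suc (suc (suc n))) (length-∷ʳ v e)) l)
        (trans (cong (λ n → suc (suc n))
          (trans (length-∷ʳ (v ∷ʳ e) f) (cong suc (length-∷ʳ v e)))) l)
        (grow q q′ s′) (zig-++ (f ∷ []) s′)) λ ()
    ... | inj₁ j with eq ← ++-assoc v (e ∷ []) (f ∷ s)
      with s₁ , t , g , k , h ← pure-window (b ∷ c ∷ d ∷ v ∷ʳ e) f s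
        (trans (cong (λ n → suc (suc (suc n))) (length-∷ʳ v e)) l) (q ∷ j)
        (subst (λ u → Proper (b ∷ c ∷ d ∷ u)) (sym eq) (proper-tail pr))
        (subst (λ u → Monochromatic r (lift σ) z (b ∷ c ∷ d ∷ u)) (sym eq) (mono-tail m)) =
      e ∷ s₁ , t , cong (e ∷_) g ,
      p ∷ subst (λ u → Linked R (b ∷ c ∷ d ∷ u)) (++-assoc v (e ∷ []) s₁) k , h
    pure-window [] _ (_ ∷ _) refl = contradiction 4≤r λ ()
    pure-window (_ ∷ []) _ (_ ∷ _) refl = contradiction 4≤r λ { (s≤s ()) }
    pure-window (_ ∷ _ ∷ []) _ (_ ∷ _) refl = contradiction 4≤r λ { (s≤s (s≤s ())) }
    pure-window (_ ∷ _ ∷ _ ∷ []) _ (_ ∷ _) refl = contradiction 4≤r λ { (s≤s (s≤s (s≤s ()))) }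

    whole : ∀ v e s → length v ≡ r → Linked R v → Proper (v ++ e ∷ s) →
      Monochromatic r (lift σ) z (v ++ e ∷ s) →
      ∃₂ λ q t → v ++ e ∷ s ≡ q ++ t × Linked R q × length t ≤ 1
    whole v e s l i pr m with s₁ , t , g , k , h ← pure-window v e s l i pr m =
      v ++ s₁ , t , trans (cong (v ++_) g) (sym (++-assoc v s₁ t)) , k , h

    -- The first window turns at `b`. If the next one turns at `c`, its turn is of the opposite kind
    -- and so is its colour; if it turns later, it clashes with the window after it. So it is
    -- monotone.
    after-turn : ∀ {a b c d y₀} u e f s → suc (suc (suc (suc (length u)))) ≡ r →
      Linked R (b ∷ c ∷ d ∷ u ∷ʳ e) ⊎ Zig (b ∷ c ∷ d ∷ u ∷ʳ e) (not y₀) ⊎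
        ∃ (λ y → Zig (b ∷ c ∷ d ∷ u ∷ʳ e) (not y) × Zig (c ∷ d ∷ u ∷ʳ e) y) →
      Zig (a ∷ b ∷ c ∷ d ∷ u) y₀ → Proper (b ∷ c ∷ d ∷ u ++ e ∷ f ∷ s) →
      Monochromatic r (lift σ) z (a ∷ b ∷ c ∷ d ∷ u ++ e ∷ f ∷ s) →
      ∃₂ λ q t → b ∷ c ∷ d ∷ u ++ e ∷ f ∷ s ≡ q ++ t × Linked R q × length t ≤ 1
    after-turn {a} {b} {c} {d} {y₀} u e f s l cases t pr m = go cases
      where
      eq : (u ∷ʳ e) ++ f ∷ s ≡ u ++ e ∷ f ∷ s
      eq = ++-assoc u (e ∷ []) (f ∷ s)
      lenₑ : length (b ∷ c ∷ d ∷ u ∷ʳ e) ≡ r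
      lenₑ = trans (cong (λ n → suc (suc (suc n))) (length-∷ʳ u e)) l
      go : _ → _
      go (inj₁ i) = subst (λ w → ∃₂ λ q t → b ∷ c ∷ d ∷ w ≡ q ++ t × Linked R q × length t ≤ 1) eq
        (whole (b ∷ c ∷ d ∷ u ∷ʳ e) f s lenₑ i
          (subst (λ w → Proper (b ∷ c ∷ d ∷ w)) (sym eq) pr)
          (subst (λ w → Monochromatic r (lift σ) z (b ∷ c ∷ d ∷ w)) (sym eq) (mono-tail m)))
      go (inj₂ (inj₁ t′)) = contradiction (clash {p = a ∷ []} {s = f ∷ s} {p′ = []} m
        (cong (λ w → a ∷ b ∷ c ∷ d ∷ w) (sym eq)) refl lenₑ l t′ t) λ ()
      go (inj₂ (inj₂ (y , t′ , t″))) = contradiction (clash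
        {p = a ∷ []} {s = f ∷ s} {p′ = a ∷ b ∷ []} m
        (cong (λ w → a ∷ b ∷ c ∷ d ∷ w) (sym eq))
        (cong (λ w → a ∷ b ∷ c ∷ d ∷ w) (trans (sym eq) (sym (++-assoc (u ∷ʳ e) (f ∷ []) s))))
        lenₑ
        (trans (cong (λ n → suc (suc n)) (length-∷ʳ (u ∷ʳ e) f)) lenₑ)
        t′ (zig-++ (f ∷ []) t″)) λ ()

  private
    extend-inc : ∀ {c d w e} → Inc (c ∷ d ∷ w) → Proper (c ∷ d ∷ w ∷ʳ e) →
      Inc (c ∷ d ∷ w ∷ʳ e) ⊎ ∃ (Zig (c ∷ d ∷ w ∷ʳ e))
    extend-inc (p ∷ _) pr with trichotomy pr
    ... | inj₁ i = inj₁ i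
    ... | inj₂ (inj₁ (q ∷ _)) = contradiction p (<-asym q)
    ... | inj₂ (inj₂ s) = inj₂ s

    extend-dec : ∀ {c d w e} → Dec (c ∷ d ∷ w) → Proper (c ∷ d ∷ w ∷ʳ e) →
      Dec (c ∷ d ∷ w ∷ʳ e) ⊎ ∃ (Zig (c ∷ d ∷ w ∷ʳ e))
    extend-dec (p ∷ _) pr with trichotomy pr
    ... | inj₁ (q ∷ _) = contradiction p (<-asym q)
    ... | inj₂ s = s

    fall-cases : ∀ {b c d w} → b > c → Proper (b ∷ c ∷ d ∷ w) → Dec (b ∷ c ∷ d ∷ w) ⊎
      Zig (b ∷ c ∷ d ∷ w) false ⊎ ∃ λ y → Zig (b ∷ c ∷ d ∷ w) (not y) × Zig (c ∷ d ∷ w) y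
    fall-cases p pr with trichotomy pr
    ... | inj₁ (q ∷ _) = contradiction p (<-asym q)
    ... | inj₂ (inj₁ d) = inj₁ d
    ... | inj₂ (inj₂ (_ , peak q _)) = contradiction p (<-asym q)
    ... | inj₂ (inj₂ (_ , up q _ _)) = contradiction p (<-asym q)
    ... | inj₂ (inj₂ (_ , valley q s)) = inj₂ (inj₁ (valley q s))
    ... | inj₂ (inj₂ (_ , down q s t)) = inj₂ (inj₂ (_ , down q s t , t))

    rise-cases : ∀ {b c d w} → b < c → Proper (b ∷ c ∷ d ∷ w) → Inc (b ∷ c ∷ d ∷ w) ⊎
      Zig (b ∷ c ∷ d ∷ w) true ⊎ ∃ λ y → Zig (b ∷ c ∷ d ∷ w) (not y) × Zig (c ∷ d ∷ w) y
    rise-cases p pr with trichotomy pr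
    ... | inj₁ i = inj₁ i
    ... | inj₂ (inj₁ (q ∷ _)) = contradiction p (<-asym q)
    ... | inj₂ (inj₂ (_ , valley q _)) = contradiction p (<-asym q)
    ... | inj₂ (inj₂ (_ , down q _ _)) = contradiction p (<-asym q)
    ... | inj₂ (inj₂ (_ , peak q s)) = inj₂ (inj₁ (peak q s))
    ... | inj₂ (inj₂ (_ , up q s t)) = inj₂ (inj₂ (_ , up q s t , t))

  NearlyPure : ℕ → Word → Set
  NearlyPure n w = ∃ λ p → ∃₂ λ q t →
    w ≡ p ++ q ++ t × (Inc q ⊎ Dec q) × length p + length t ≤ n

  -- A turn of the first window beyond its second letter recurs in the next window after a run
  -- shorter by one, with the opposite colour. At most the first and the last letter of the word
  -- then break a single monotone stretch.
  long-nearlyPure : ∀ v e f s → length v ≡ r → Proper (v ++ e ∷ f ∷ s) →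
    Monochromatic r (lift σ) z (v ++ e ∷ f ∷ s) → NearlyPure 2 (v ++ e ∷ f ∷ s)
  long-nearlyPure [] _ _ _ refl = contradiction 4≤r λ ()
  long-nearlyPure (_ ∷ []) _ _ _ refl = contradiction 4≤r λ { (s≤s ()) }
  long-nearlyPure (_ ∷ _ ∷ []) _ _ _ refl = contradiction 4≤r λ { (s≤s (s≤s ())) }
  long-nearlyPure (_ ∷ _ ∷ _ ∷ []) _ _ _ refl = contradiction 4≤r λ { (s≤s (s≤s (s≤s ()))) }
  long-nearlyPure v@(a ∷ b ∷ c ∷ d ∷ u) e f s l pr m = go (trichotomy (proper-++⁻ˡ v pr))
    where
    eq : u ++ e ∷ f ∷ s ≡ (u ∷ʳ e) ++ f ∷ s
    eq = sym (++-assoc u (e ∷ []) (f ∷ s))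
    second : Proper (b ∷ c ∷ d ∷ u ∷ʳ e)
    second = proper-++⁻ˡ (b ∷ c ∷ d ∷ u ∷ʳ e)
      (subst (λ w → Proper (b ∷ c ∷ d ∷ w)) eq (proper-tail pr))
    run : ∀ {y} → Zig v (not y) → Zig (b ∷ c ∷ d ∷ u) y → ⊥
    run t t′ = clash {p = []} {p′ = a ∷ []} m refl (cong (λ w → a ∷ b ∷ c ∷ d ∷ w) eq) l
      (trans (cong (λ n → suc (suc (suc n))) (length-∷ʳ u e)) l) t (zig-++ (e ∷ []) t′)
    go : Inc v ⊎ Dec v ⊎ ∃ (Zig v) → NearlyPure 2 (v ++ e ∷ f ∷ s)
    go (inj₁ i) with q , t , g , k , h ← whole up extend-inc v e (f ∷ s) l i pr m =
      [] , q , t , g , inj₁ k , ≤-trans h (s≤s z≤n)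
    go (inj₂ (inj₁ i)) with q , t , g , k , h ← whole down extend-dec v e (f ∷ s) l i pr m =
      [] , q , t , g , inj₂ k , ≤-trans h (s≤s z≤n)
    go (inj₂ (inj₂ (_ , up p p′ t))) = contradiction (run (up p p′ t) t) λ ()
    go (inj₂ (inj₂ (_ , down p p′ t))) = contradiction (run (down p p′ t) t) λ ()
    go (inj₂ (inj₂ (_ , peak p p′)))
      with q , t , g , k , h ← after-turn down extend-dec u e f s l
        (fall-cases p′ second) (peak p p′) (proper-tail pr) m =
      a ∷ [] , q , t , cong (a ∷_) g , inj₂ k , s≤s h
    go (inj₂ (inj₂ (_ , valley p p′)))
      with q , t , g , k , h ← after-turn up extend-inc u e f s l
        (rise-cases p′ second) (valley p p′) (proper-tail pr) m =
      a ∷ [] , q , t , cong (a ∷_) g , inj₁ k , s≤s h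

  nearlyPure : ∀ {w} → Proper w → Monochromatic r (lift σ) z w → NearlyPure (suc r) w
  nearlyPure {w} pr m with length w ≤? suc r
  -- A short word counts entirely as exception; this is what costs `suc r`.
  ... | yes short = w , [] , [] , sym (++-identityʳ w) , inj₁ [] ,
    subst (_≤ suc r) (sym (+-identityʳ (length w))) short
  ... | no long = go (take r w) (drop r w) (take++drop≡id r w)
    (trans (length-take r w) (m≤n⇒m⊓n≡m (≤-trans (n≤1+n r) (<⇒≤ (≰⇒> long)))))
    where
    go : ∀ v s → v ++ s ≡ w → length v ≡ r → NearlyPure (suc r) w
    go v [] refl l = contradiction
      (subst (_≤ suc r) (sym (trans (cong length (++-identityʳ v)) l)) (n≤1+n r)) long
    go v (e ∷ []) refl l = contradiction
      (subst (_≤ suc r) (sym (trans (length-∷ʳ v e) (cong suc l))) ≤-refl) long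
    go v (e ∷ f ∷ s) refl l with p , q , t , g , k , h ← long-nearlyPure v e f s l pr m =
      p , q , t , g , k , ≤-trans h (≤-trans (s≤s (s≤s z≤n)) (≤-trans 4≤r (n≤1+n r)))

-- Growth of the path bound under stepping up.

gaps-bound : ∀ {r V B σ} →
  (∀ {w z} → Proper w → All (_< V) w → Monochromatic (suc r) (lift σ) z w → length w ≤ B) →
  PathBound (suc (suc r)) (2 ^ V) (suc B) (λ v → lift σ (gaps v))
gaps-bound f {[]} _ _ _ = z≤n
gaps-bound {σ = σ} f {x ∷ w} i a m = s≤s (subst (_≤ _) (length-gaps x w)
  (f (gaps-proper i) (gaps-< i a) (mono-gaps {c = lift σ} m)))

stepUp-bound₂ : ∀ {V B σ} → (∀ w → σ w ≡ false) → PathBound 2 V B σ →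
  PathBound 3 (2 ^ V) (suc B) (λ v → lift σ (gaps v))
stepUp-bound₂ h b = gaps-bound λ {w} pr a m →
  pure-bound ≤-refl b [] w [] (sym (++-identityʳ w)) (pure₂ h pr m) a m

-- Colour `true` excludes valleys and `false` excludes peaks, so the gap word splits into two
-- monotone halves, each bounded by `B`.
stepUp-bound₃ : ∀ {V B σ} → PathBound 3 V B σ →
  PathBound 4 (2 ^ V) (suc (B + B)) (λ v → lift σ (gaps v))
stepUp-bound₃ {V} {B} {σ} b = gaps-bound go
  where
  2≤3 : 2 ≤ 3
  2≤3 = s≤s (s≤s z≤n)
  halves : ∀ {w z} p s → w ≡ p ++ s → Inc p ⊎ Dec p → Inc s ⊎ Dec s → All (_< V) w →
    Monochromatic 3 (lift σ) z w → length w ≤ B + B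
  halves p s refl i j a m = subst (_≤ B + B) (sym (length-++ p)) (+-mono-≤
    (pure-bound 2≤3 b [] p s refl i a m)
    (pure-bound 2≤3 b p s [] (cong (p ++_) (sym (++-identityʳ s))) j a m))
  go : ∀ {w z} → Proper w → All (_< V) w → Monochromatic 3 (lift σ) z w → length w ≤ B + B
  go {w} {true} pr a m with p , s , e , i , j ← one-turn ≢⇒<⊎> pr
    (λ p s e q r → contradiction
      (trans (sym (lift-zig σ (valley q r))) (m .colour p _ s e refl)) λ ()) =
    halves p s e (inj₁ i) (inj₂ j) a m
  go {w} {false} pr a m with p , s , e , i , j ← one-turn ≢⇒>⊎< pr
    (λ p s e q r → contradiction
      (trans (sym (lift-zig σ (peak q r))) (m .colour p _ s e refl)) λ ()) =
    halves p s e (inj₂ i) (inj₁ j) a m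

stepUp-bound : ∀ {r V B σ} → 4 ≤ suc r → PathBound (suc r) V B σ →
  PathBound (suc (suc r)) (2 ^ V) (suc (B + suc (suc r))) (λ v → lift σ (gaps v))
stepUp-bound {r} {V} {B} {σ} 4≤ b = gaps-bound go
  where
  go : ∀ {w z} → Proper w → All (_< V) w → Monochromatic (suc r) (lift σ) z w →
    length w ≤ B + suc (suc r)
  go pr a m with p , q , t , refl , k , h ← nearlyPure 4≤ pr m = begin
    length (p ++ q ++ t)               ≡⟨ length-++ p ⟩
    length p + length (q ++ t)         ≡⟨ cong (length p +_) (length-++ q) ⟩
    length p + (length q + length t)   ≡⟨ +-assoc (length p) _ _ ⟨
    length p + length q + length t     ≡⟨ cong (_+ length t) (+-comm (length p) (length q)) ⟩
    length q + length p + length t     ≡⟨ +-assoc (length q) _ _ ⟩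
    length q + (length p + length t)
      ≤⟨ +-mono-≤ (pure-bound (≤-trans (s≤s (s≤s z≤n)) 4≤) b p q t refl k a m) h ⟩
    B + suc (suc r)                    ∎
    where open ≤-Reasoning

-- The iterated colouring and its path bound.

colouring : ℕ → Word → Bool
colouring zero    _ = false
colouring (suc j) v = lift (colouring j) (gaps v)

signotope : ∀ j → Signotope (suc (suc j)) (colouring j)
signotope zero    = constant
signotope (suc j) = stepUp (s≤s (s≤s z≤n)) (signotope j)

inc-length : ∀ {M a w} → Inc (a ∷ w) → All (_< M) (a ∷ w) → a + length (a ∷ w) ≤ M
inc-length {M} {a} [-] (p ∷ []) = subst (_≤ M) (+-comm 1 a) p
inc-length {M} {a} {b ∷ w} (p ∷ i) (_ ∷ ps) = begin
  a + suc (length (b ∷ w))    ≡⟨ +-suc a _ ⟩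
  suc a + length (b ∷ w)      ≤⟨ +-monoˡ-≤ _ p ⟩
  b + length (b ∷ w)          ≤⟨ inc-length i ps ⟩
  M                           ∎
  where open ≤-Reasoning

colouring-bound₃ : ∀ M → PathBound 3 (tow 2 M) (suc M) (colouring 1)
colouring-bound₃ M = stepUp-bound₂ (λ _ → refl) bound₂
  where
  bound₂ : PathBound 2 M M (colouring 0)
  bound₂ {[]}    _ _ _ = z≤n
  bound₂ {a ∷ w} i p _ = ≤-trans (m≤n+m _ a) (inc-length i p)

-- The doubling occurs once and gives `2 * M`. Each later step from `r` adds `r + 2`, which the
-- growth of the square from `r * r` to `suc r * suc r` covers.
colouring-bound₄ : ∀ M j →
  PathBound (4 + j) (tow (3 + j) M) (2 * M + (4 + j) * (4 + j)) (colouring (2 + j))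
colouring-bound₄ M zero i a m = begin
  _                        ≤⟨ stepUp-bound₃ (colouring-bound₃ M) i a m ⟩
  suc (suc M + suc M)      ≡⟨ cong (λ n → suc (suc n)) (+-suc M M) ⟩
  3 + (M + M)              ≤⟨ +-mono-≤ {3} {16} (s≤s (s≤s (s≤s z≤n))) ≤-refl ⟩
  16 + (M + M)             ≡⟨ +-comm 16 (M + M) ⟩
  M + M + 16               ≡⟨ cong (λ n → M + n + 16) (+-identityʳ M) ⟨
  2 * M + 16               ∎
  where open ≤-Reasoning
colouring-bound₄ M (suc j) i a m = begin
  _
    ≤⟨ stepUp-bound (s≤s (s≤s (s≤s (s≤s z≤n)))) (colouring-bound₄ M j) i a m ⟩
  suc (2 * M + r * r + suc r)            ≡⟨ cong suc (+-assoc (2 * M) _ _) ⟩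
  suc (2 * M + (r * r + suc r))          ≡⟨ +-suc (2 * M) _ ⟨
  2 * M + suc (r * r + suc r)            ≤⟨ +-monoʳ-≤ (2 * M) (s≤s (begin
      r * r + suc r                      ≡⟨ +-comm (r * r) _ ⟩
      suc (r + r * r)                    ≤⟨ +-monoˡ-≤ (r + r * r) {1} {r} (s≤s z≤n) ⟩
      r + (r + r * r)                    ≡⟨ cong (r +_) (*-suc r r) ⟨
      r + r * suc r                      ∎)) ⟩
  2 * M + suc r * suc r                  ∎
  where
  open ≤-Reasoning
  r = 4 + j

colouring-bound : ∀ M j →
  PathBound (3 + j) (tow (2 + j) M) (2 * M + (3 + j) * (3 + j)) (colouring (1 + j))
colouring-bound M zero i a m = ≤-trans (colouring-bound₃ M i a m) (begin
  1 + M                   ≤⟨ +-mono-≤ {1} {9} (s≤s z≤n) (m≤m+n M (M + 0)) ⟩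
  9 + 2 * M               ≡⟨ +-comm 9 (2 * M) ⟩
  2 * M + 9               ∎)
  where open ≤-Reasoning
colouring-bound M (suc j) = colouring-bound₄ M j

-- From words back to vectors of vertices.

word : ∀ {N m} → Vec (Fin N) m → Word
word v = Vec.toList (Vec.map toℕ v)

length-word : ∀ {N m} (v : Vec (Fin N) m) → length (word v) ≡ m
length-word v = length-toList (Vec.map toℕ v)

word-inc : ∀ {N m} (v : Vec (Fin N) m) → Increasing v → Inc (word v)
word-inc []          _ = []
word-inc (x ∷ [])    _ = [-]
word-inc (x ∷ y ∷ v) p = p Fin.zero (Fin.suc Fin.zero) (s≤s z≤n) ∷
  word-inc (y ∷ v) (λ i j q → p (Fin.suc i) (Fin.suc j) (s≤s q))

word-< : ∀ {N m T} → N ≤ T → (v : Vec (Fin N) m) → All (_< T) (word v)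
word-< N≤T []      = []
word-< N≤T (x ∷ v) = <-≤-trans (toℕ<n x) N≤T ∷ word-< N≤T v

deletions-word : ∀ {N m} (v : Vec (Fin N) (suc m)) →
  deletions (word v) ≡ tabulate (λ i → word (Vec.removeAt v i))
deletions-word (x ∷ [])    = refl
deletions-word (x ∷ y ∷ v) = cong (word (y ∷ v) ∷_)
  (trans (cong (map (toℕ x ∷_)) (deletions-word (y ∷ v)))
    (map-tabulate (λ i → word (Vec.removeAt (y ∷ v) i)) (toℕ x ∷_)))

seg-pair : ∀ {a z n} {g : Fin n → Bool} → Seg a z (tabulate g) → ∀ {i j} → i Fin.< j →
  g i ≡ a ⊎ g i ≡ g j
seg-pair {n = suc n} {g} (rest p) {i} {j} _ =
  inj₂ (trans (All.tabulate⁻ {f = g} p i) (sym (All.tabulate⁻ {f = g} p j)))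
seg-pair {n = suc n} (e ∷ s) {Fin.zero} _ = inj₁ e
seg-pair {n = suc n} (e ∷ s) {Fin.suc i} {Fin.suc j} (s≤s p) = seg-pair s p

seg-triple : ∀ {a z n} {g : Fin n → Bool} → Seg a z (tabulate g) → ∀ {i j k} →
  i Fin.< j → j Fin.< k →
  g j ≡ g i ⊎ g j ≡ g k
seg-triple {n = suc n} {g} (rest p) {i} {j} {k} _ _ =
  inj₂ (trans (All.tabulate⁻ {f = g} p j) (sym (All.tabulate⁻ {f = g} p k)))
seg-triple {n = suc n} (e ∷ s) {Fin.zero} {Fin.suc j} {Fin.suc k} _ (s≤s q) with seg-pair s q
... | inj₁ f = inj₁ (trans f (sym e))
... | inj₂ f = inj₂ f
seg-triple {n = suc n} (e ∷ s) {Fin.suc i} {Fin.suc j} {Fin.suc k} (s≤s p) (s≤s q) =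
  seg-triple s p q

between : ∀ {x y z} → y ≡ x ⊎ y ≡ z → (z ≤ᵇ y × y ≤ᵇ x) ⊎ (x ≤ᵇ y × y ≤ᵇ z)
between {x} {y} {z} (inj₁ refl) with Bool.≤-total z y
... | inj₁ p = inj₁ (p , b≤b)
... | inj₂ p = inj₂ (b≤b , p)
between {x} {y} {z} (inj₂ refl) with Bool.≤-total x y
... | inj₁ p = inj₂ (p , b≤b)
... | inj₂ p = inj₁ (b≤b , p)

signotope-monotone : ∀ {r N σ} → Signotope r σ → MonotoneColouring r N (λ v → σ (word v))
signotope-monotone {σ = σ} S v p i j k i<j j<k
  with a , z , s ← Signotope.monotone S (word-inc v p) (length-word v) =
  between (seg-triple (subst (Seg a z) (trans (cong (map σ) (deletions-word v))
    (map-tabulate (λ i → word (Vec.removeAt v i)) σ)) s) i<j j<k)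

drop-lookup : ∀ {N m} (u : Vec (Fin N) m) i →
  drop (toℕ i) (word u) ≡ toℕ (Vec.lookup u i) ∷ drop (suc (toℕ i)) (word u)
drop-lookup (x ∷ u) Fin.zero    = refl
drop-lookup (x ∷ u) (Fin.suc i) = drop-lookup u i

drop-length : ∀ (p : Word) {s} → drop (length p) (p ++ s) ≡ s
drop-length []      = refl
drop-length (_ ∷ p) = drop-length p

word-lookups : ∀ {N m} r (u : Vec (Fin N) m) {i} v {s} (f : Fin r → Fin m) →
  (∀ j → toℕ (f j) ≡ toℕ j + i) → drop i (word u) ≡ v ++ s → length v ≡ r →
  word (Vec.tabulate (λ j → Vec.lookup u (f j))) ≡ v
word-lookups zero u [] f _ _ _ = refl
word-lookups (suc r) u {i} (a ∷ v) f pos e l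
  with refl ← pos Fin.zero
  with eq , eqs ← ∷-injective (trans (sym (drop-lookup u (f Fin.zero))) e) =
  cong₂ _∷_ eq (word-lookups r u v (λ j → f (Fin.suc j))
    (λ j → trans (pos (Fin.suc j)) (sym (+-suc (toℕ j) _))) eqs (suc-injective l))

path-monochromatic : ∀ {r m N σ z} (u : Vec (Fin N) m) →
  (∀ i (p : i + r ≤ m) → σ (word (window r u i p)) ≡ z) → Monochromatic r σ z (word u)
path-monochromatic {r} {m} {σ = σ} u h .Monochromatic.colour p v s e refl =
  trans (cong σ (sym eq)) (h (length p) bound)
  where
  bound : length p + length v ≤ m
  bound = begin
    length p + length v               ≤⟨ +-monoʳ-≤ (length p) (m≤m+n (length v) (length s)) ⟩
    length p + (length v + length s)  ≡⟨ cong (length p +_) (length-++ v) ⟨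
    length p + length (v ++ s)        ≡⟨ length-++ p ⟨
    length (p ++ v ++ s)              ≡⟨ cong length e ⟨
    length (word u)                   ≡⟨ length-word u ⟩
    m                                 ∎
    where open ≤-Reasoning
  position : (j : Fin (length v)) → toℕ j + length p < m
  position j = <-≤-trans (+-monoˡ-< (length p) (toℕ<n j))
    (≤-trans (≤-reflexive (+-comm (length v) (length p))) bound)
  eq : word (window (length v) u (length p) bound) ≡ v
  eq = word-lookups (length v) u v _ (λ j → toℕ-fromℕ< (position j))
    (trans (cong (drop (length p)) e) (drop-length p)) refl

-- The tower bound, with an arbitrarily small fraction of `n` given up.

theorem2p1 : (r : ℕ) → 3 ≤ r → (k : ℕ) →
    Σ ℕ λ n₀ → (n : ℕ) → 1 ≤ n → n₀ ≤ n →
    (N : ℕ) → MonArrows r (2 * n + r ∸ 1) N →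
    tow (r ∸ 1) (n ∸ n / suc k) ≤ N
-- This threshold makes `n / suc k` at least `r * r`, the additive error of the path bound.
theorem2p1 r@(suc (suc (suc j))) (s≤s (s≤s (s≤s z≤n))) k = r * r * suc k , bound
  where
  bound : (n : ℕ) → 1 ≤ n → r * r * suc k ≤ n → (N : ℕ) → MonArrows r (2 * n + r ∸ 1) N →
    tow (r ∸ 1) (n ∸ n / suc k) ≤ N
  bound n _ n₀≤n N arrows = ≮⇒≥ λ N<tow →
    let S = signotope (suc j)
        u , p , _ , h = arrows (λ v → colouring (suc j) (word v)) (signotope-monotone S)
        short = colouring-bound M j (word-inc u p) (word-< (<⇒≤ N<tow) u)
                  (path-monochromatic {σ = colouring (suc j)} u h)
    in <⇒≱ long (subst (_≤ 2 * M + r * r) (length-word u) short)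
    where
    q = n / suc k
    M = n ∸ q
    r²≤q : r * r ≤ q
    r²≤q = subst (_≤ q) (m*n/n≡m (r * r) (suc k)) (/-monoˡ-≤ (suc k) n₀≤n)
    long : 2 * M + r * r < 2 * n + r ∸ 1
    long = begin-strict
      -- Lowering `n` by `q` frees `2 * q`, more than enough for the error; the positive `r ∸ 1`
      -- makes the inequality strict.
      2 * M + r * r           ≤⟨ +-monoʳ-≤ (2 * M) r²≤q ⟩
      2 * M + q               ≤⟨ +-monoʳ-≤ (2 * M) (m≤m+n q (q + 0)) ⟩
      2 * M + 2 * q           ≡⟨ *-distribˡ-+ 2 M q ⟨
      2 * (M + q)             ≡⟨ cong (2 *_) (m∸n+n≡m (m/n≤m n (suc k))) ⟩
      2 * n                   <⟨ m<m+n (2 * n) (s≤s z≤n) ⟩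
      2 * n + (r ∸ 1)         ≡⟨ +-∸-assoc (2 * n) {r} (s≤s z≤n) ⟨
      2 * n + r ∸ 1           ∎
      where open ≤-Reasoning
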